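{- For every integer $t\ge 2$, there exists a $(12t+4,3,2)$-BIBD $(X,\mathcal{A})$ with a weak nesting $\phi:\mathcal{A}\to Y$, $X\subseteq Y$, where $|Y|=w=14t+6$.
   Context: A $(v,k,\lambda)$-BIBD is a pair $(X,\mathcal{A})$ where $X$ is a set of $v$ points and $\mathcal{A}$ is a multiset of $k$-subsets of $X$ (blocks) such that every pair of distinct points lies in exactly $\lambda$ blocks. A partial $(w,k,\lambda)$-BIBD is defined in the same way on $w$ points, except that every pair lies in at most $\lambda$ blocks. Given a $(v,k,\lambda)$-BIBD $(X,\mathcal{A})$ and a set $Y\supseteq X$ with $|Y|=w$, a map $\phi:\mathcal{A}\to Y$ is a weak nesting if $\phi(A)\notin A$ for every block $A$ and the multiset $\{A\cup\{\phi(A)\}:A\in\mathcal{A}\}$ is a partial $(w,k+1,\lambda+1)$-BIBD on $Y$. -}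

module Defs where

open import Data.Nat using (ℕ; _≤_)
open import Data.Fin using (Fin)
open import Data.Fin.Subset using (Subset; _∈_; _∉_; _⊆_; _∪_; ⁅_⁆; ∣_∣)
open import Data.Fin.Subset.Properties using (_∈?_)
open import Data.List using (List; length; filter; lookup; tabulate)
open import Data.List.Relation.Unary.All using (All)
open import Data.Product using (_×_)
open import Relation.Nullary.Decidable using (_×-dec_)
open import Relation.Binary.PropositionalEquality using (_≡_; _≢_)

-- Finite sets of points are subsets of an ambient Fin n, where n may exceed
-- the number of points.  A multiset of blocks is a list, whose order plays no
-- role in the definitions below.

pairCount : ∀ {n} → List (Subset n) → Fin n → Fin n → ℕ
pairCount 𝒜 x y = length (filter (λ B → (x ∈? B) ×-dec (y ∈? B)) 𝒜)

-- Instantiating _∼_ below with equality gives designs in which each pair is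
-- covered exactly μ times; instantiating it with _≤_ gives at most μ times.
record IsDesign (_∼_ : ℕ → ℕ → Set) (v k μ : ℕ)
                {n : ℕ} (X : Subset n) (𝒜 : List (Subset n)) : Set where
  field
    points : ∣ X ∣ ≡ v
    blocks : All (λ B → B ⊆ X × ∣ B ∣ ≡ k) 𝒜
    pairs  : ∀ {x y} → x ∈ X → y ∈ X → x ≢ y → pairCount 𝒜 x y ∼ μ

IsBIBD : (v k μ : ℕ) {n : ℕ} → Subset n → List (Subset n) → Set
IsBIBD = IsDesign _≡_

IsPartialBIBD : (w k μ : ℕ) {n : ℕ} → Subset n → List (Subset n) → Set
IsPartialBIBD = IsDesign _≤_

-- A map defined on a multiset of blocks is a function of the positions in the
-- list, so that repeated copies of a block may have different images.
augment : ∀ {n} (𝒜 : List (Subset n)) → (Fin (length 𝒜) → Fin n) → List (Subset n)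
augment 𝒜 φ = tabulate (λ i → lookup 𝒜 i ∪ ⁅ φ i ⁆)

record IsWeakNesting (v w k μ : ℕ) {n : ℕ} (X Y : Subset n) (𝒜 : List (Subset n))
                     (φ : Fin (length 𝒜) → Fin n) : Set where
  field
    bibd    : IsBIBD v k μ X 𝒜
    X⊆Y     : X ⊆ Y
    ∣Y∣≡w   : ∣ Y ∣ ≡ w
    into    : ∀ i → φ i ∈ Y
    avoids  : ∀ i → φ i ∉ lookup 𝒜 i
    partial : IsPartialBIBD w (ℕ.suc k) (ℕ.suc μ) Y (augment 𝒜 φ)

{-# OPTIONS --safe #-}
module Submission where

-- With n = 4t + 1, take X = (ℤₙ × ℤ₃) ∪ {∞} and the translates of
--   {(S + d , 0) , (S − d , 0) , (S , 1)}   for 4t pairs (S , d) in which, up to sign,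
--                                           d takes every nonzero value exactly twice,
--   {∞ , (0 , 0) , (0 , 1)}   and   {(0 , 0) , (0 , 1) , (0 , 2)}.
-- This is a doubled Bose design.  The triples of the third kind, and the translates of each
-- of 2t + 1 Bose triples, are nested with new points of their own; the remaining Bose
-- triples, namely those with
--   (S , d) = (t − i , 3i) for 1 ≤ i < t   and   (t + j , 3j − 1) for 1 ≤ j ≤ t,
-- are nested with (0 , 1), and {∞ , (0 , 0) , (0 , 1)} is nested with (3t , 2).
-- The differences added by the internal nestings are then all distinct: the pure ones are
-- ±1, …, ±(t − 1), ±(t + 1), …, ±2t, and the mixed ones, translated by t and halved,
-- are ±1, …, ±2t.  Counting is done with sums of indicators, so both facts become
-- rearrangements of sums over intervals.

open import Defs
open import Data.Nat as ℕ using (ℕ; zero; suc; NonZero; z≤n; s≤s; _≤_)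
import Data.Nat.Divisibility as ℕ
import Data.Nat.Properties as ℕ
import Data.Nat.Tactic.RingSolver as ℕ-Solver
open import Data.Fin using (Fin; zero; suc; toℕ; fromℕ<; combine; _↑ˡ_; _↑ʳ_; splitAt; join; _≟_)
import Data.Fin.Properties as Fin
open import Data.Fin.Subset using (Subset; _∈_; _∉_; _∪_; ⁅_⁆; ⊤; ⊥; ∣_∣; inside; outside)
open import Data.Fin.Subset.Properties
  using (_∈?_; ∈⊤; ⊆⊤; ∉⊥; ∣⊤∣≡n; ∣⊥∣≡0; x∈⁅x⁆; x∈⁅y⁆⇒x≡y; x∈p∪q⁻; x∈p∪q⁺; ∪-identityˡ; ∪-comm)
open import Data.Vec as Vec using (_∷_; here; there)
open import Data.List
  using (List; []; _∷_; _++_; map; concatMap; filter; foldr; replicate; downFrom; allFin; lookup; length)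
import Data.List.Properties as List
open import Data.List.Membership.Propositional.Properties using (∈-lookup)
open import Data.List.Relation.Unary.All as All using (All; []; _∷_)
import Data.List.Relation.Unary.All.Properties as All
open import Data.List.Relation.Unary.AllPairs as AllPairs using (AllPairs; []; _∷_)
import Data.List.Relation.Unary.AllPairs.Properties as AllPairs
open import Data.List.Relation.Unary.Unique.Propositional using (Unique)
open import Data.Product using (_×_; _,_; proj₁; Σ-syntax)
open import Data.Sum using (_⊎_; inj₁; inj₂; [_,_]′)
open import Function using (_∘_; id)
open import Relation.Nullary using (Dec; yes; no; ¬_; contradiction)
open import Relation.Nullary.Decidable using (_×-dec_)
open import Relation.Binary.PropositionalEquality

-- The blocks already cover every old pair twice, so nesting may add at most one to each old pair,
-- whereas a new point may meet an old point three times. An orbit of a Bose triple contains every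
-- point of ℤₙ × ℤ₃ three times, so one new point absorbs exactly one such orbit. Of the 2t + 2 new
-- points one serves the triples of the third kind; hence 2t - 1 of the 4t Bose orbits must be
-- nested inside `X`. The constants come from the values S ± d. They are t + 2i and t - 4i in one
-- family, t + 4j - 1 and t - 2j + 1 in the other. Subtracting t and halving modulo 4t + 1 gives i,
-- -2i, -(2t + 1 - 2j) and 2t + 1 - j, which is all of ±1, ..., ±2t except t and -2t. Undoing the
-- halving, these two become 3t and -3t. The nesting point (3t , 2) supplies both, because its level
-- differs from those of (0 , 0) and (0 , 1) by -1 and by 1. The radii 3i and 3j - 1 are distinct
-- modulo n, so up to sign none occurs more than twice, and the list of radii can be completed.

module Summation where

  -- Indicators and finite sums

  open import Data.Nat using (_+_; _*_; _<_)

  private variable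
    A B : Set

  𝟙 : {P : Set} → Dec P → ℕ
  𝟙 (yes _) = 1
  𝟙 (no  _) = 0

  𝟙-true : ∀ {P : Set} (p? : Dec P) → P → 𝟙 p? ≡ 1
  𝟙-true (yes _) _ = refl
  𝟙-true (no ¬p) p = contradiction p ¬p

  𝟙-false : ∀ {P : Set} (p? : Dec P) → ¬ P → 𝟙 p? ≡ 0
  𝟙-false (no _)  _  = refl
  𝟙-false (yes p) ¬p = contradiction p ¬p

  𝟙-cong : ∀ {P Q : Set} (p? : Dec P) (q? : Dec Q) → (P → Q) → (Q → P) → 𝟙 p? ≡ 𝟙 q?
  𝟙-cong (yes p) q? f g = sym (𝟙-true q? (f p))
  𝟙-cong (no ¬p) q? f g = sym (𝟙-false q? (¬p ∘ g))

  opaque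
    -- Opaque, so that sums over lists of known shape, such as `downFrom 3` or `downFrom t` with
    -- `t = suc s`, stay folded in goals and are opened only by lemmas that ask for it.
    ∑ : List A → (A → ℕ) → ℕ
    ∑ []       f = 0
    ∑ (x ∷ xs) f = f x + ∑ xs f

    ∑-++ : ∀ (xs ys : List A) f → ∑ (xs ++ ys) f ≡ ∑ xs f + ∑ ys f
    ∑-++ []       ys f = refl
    ∑-++ (x ∷ xs) ys f = trans (cong (f x +_) (∑-++ xs ys f)) (sym (ℕ.+-assoc (f x) _ _))

    ∑-map : ∀ (g : A → B) xs f → ∑ (map g xs) f ≡ ∑ xs (f ∘ g)
    ∑-map g []       f = refl
    ∑-map g (x ∷ xs) f = cong (f (g x) +_) (∑-map g xs f)

    ∑-concatMap : ∀ (g : A → List B) xs f → ∑ (concatMap g xs) f ≡ ∑ xs (λ x → ∑ (g x) f)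
    ∑-concatMap g []       f = refl
    ∑-concatMap g (x ∷ xs) f =
      trans (∑-++ (g x) (concatMap g xs) f) (cong (∑ (g x) f +_) (∑-concatMap g xs f))

    ∑-cong : ∀ (xs : List A) {f g} → (∀ x → f x ≡ g x) → ∑ xs f ≡ ∑ xs g
    ∑-cong []       eq = refl
    ∑-cong (x ∷ xs) eq = cong₂ _+_ (eq x) (∑-cong xs eq)

    ∑-zero : ∀ (xs : List A) {f} → (∀ x → f x ≡ 0) → ∑ xs f ≡ 0
    ∑-zero []       eq = refl
    ∑-zero (x ∷ xs) eq = cong₂ _+_ (eq x) (∑-zero xs eq)

    ∑-one : ∀ (xs : List A) → ∑ xs (λ _ → 1) ≡ length xs
    ∑-one []       = refl
    ∑-one (x ∷ xs) = cong suc (∑-one xs)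

    ∑-+ : ∀ (xs : List A) f g → ∑ xs (λ x → f x + g x) ≡ ∑ xs f + ∑ xs g
    ∑-+ []       f g = refl
    ∑-+ (x ∷ xs) f g = trans (cong (f x + g x +_) (∑-+ xs f g)) (swap (f x) (g x) _ _)
      where
      swap : ∀ a b c d → a + b + (c + d) ≡ a + c + (b + d)
      swap = ℕ-Solver.solve-∀

    ∑-*ˡ : ∀ a (xs : List A) f → ∑ xs (λ x → a * f x) ≡ a * ∑ xs f
    ∑-*ˡ a []       f = sym (ℕ.*-zeroʳ a)
    ∑-*ˡ a (x ∷ xs) f = trans (cong (a * f x +_) (∑-*ˡ a xs f)) (sym (ℕ.*-distribˡ-+ a (f x) _))

    ∑-*ʳ : ∀ (xs : List A) f a → ∑ xs (λ x → f x * a) ≡ ∑ xs f * a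
    ∑-*ʳ xs f a = trans (∑-cong xs λ x → ℕ.*-comm (f x) a) (trans (∑-*ˡ a xs f) (ℕ.*-comm a _))

    ∑-swap : ∀ (xs : List A) (ys : List B) (f : A → B → ℕ) →
             ∑ xs (λ x → ∑ ys (λ y → f x y)) ≡ ∑ ys (λ y → ∑ xs (λ x → f x y))
    ∑-swap []       ys f = sym (∑-zero ys λ _ → refl)
    ∑-swap (x ∷ xs) ys f =
      trans (cong (∑ ys (f x) +_) (∑-swap xs ys f)) (sym (∑-+ ys (f x) _))

    ∑-* : ∀ (xs : List A) (ys : List B) f g →
          ∑ xs f * ∑ ys g ≡ ∑ xs (λ x → ∑ ys (λ y → f x * g y))
    ∑-* xs ys f g =
      trans (sym (∑-*ʳ xs f _)) (∑-cong xs λ x → sym (∑-*ˡ (f x) ys g))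

    ∑-cong-< : ∀ m {f g} → (∀ {i} → i < m → f i ≡ g i) → ∑ (downFrom m) f ≡ ∑ (downFrom m) g
    ∑-cong-< zero    eq = refl
    ∑-cong-< (suc m) eq = cong₂ _+_ (eq ℕ.≤-refl) (∑-cong-< m (eq ∘ ℕ.m<n⇒m<1+n))

    ∑-split : ∀ a b f → ∑ (downFrom (a + b)) f ≡ ∑ (downFrom a) f + ∑ (downFrom b) (λ i → f (a + i))
    ∑-split a zero    f rewrite ℕ.+-identityʳ a = sym (ℕ.+-identityʳ _)
    ∑-split a (suc b) f rewrite ℕ.+-suc a b | ∑-split a b f =
      swap (f (a + b)) (∑ (downFrom a) f) _
      where
      swap : ∀ x y z → x + (y + z) ≡ y + (x + z)
      swap = ℕ-Solver.solve-∀

    -- The relation `i + suc j ≡ m` expresses j = m - 1 - i without truncated subtraction; two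
    -- summands are allowed so that reversal and simplification happen together.
    ∑-reverse : ∀ m f g → (∀ i j → i + suc j ≡ m → f i ≡ g j) →
                ∑ (downFrom m) f ≡ ∑ (downFrom m) g
    ∑-reverse zero    f g eq = refl
    ∑-reverse (suc m) f g eq = trans
      (cong₂ _+_ (eq m 0 (ℕ.+-comm m 1))
                 (∑-reverse m f (g ∘ suc) λ i j e → eq i (suc j) (trans (ℕ.+-suc i (suc j)) (cong suc e))))
      (sym (trans (∑-split 1 m g) (cong (_+ ∑ (downFrom m) (g ∘ suc)) (ℕ.+-identityʳ (g 0)))))

    ∑-mod2 : ∀ m f → ∑ (downFrom (m * 2)) f
           ≡ ∑ (downFrom m) (λ i → f (i * 2)) + ∑ (downFrom m) (λ i → f (suc (i * 2)))
    ∑-mod2 zero    f = refl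
    ∑-mod2 (suc m) f rewrite ∑-mod2 m f = swap (f (m * 2)) (f (suc (m * 2))) _ _
      where
      swap : ∀ a b x y → b + (a + (x + y)) ≡ a + x + (b + y)
      swap = ℕ-Solver.solve-∀

    ∑-mod3 : ∀ m f → ∑ (downFrom (m * 3)) f
           ≡ ∑ (downFrom m) (λ i → f (i * 3)) + ∑ (downFrom m) (λ i → f (1 + i * 3))
             + ∑ (downFrom m) (λ i → f (2 + i * 3))
    ∑-mod3 zero    f = refl
    ∑-mod3 (suc m) f rewrite ∑-mod3 m f =
      swap (f (m * 3)) (f (1 + m * 3)) (f (2 + m * 3)) _ _ _
      where
      swap : ∀ a b c x y z → c + (b + (a + (x + y + z))) ≡ a + x + (b + y) + (c + z)
      swap = ℕ-Solver.solve-∀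

    ∑-𝟙-≤ : ∀ m r → m ≤ r → ∑ (downFrom m) (λ i → 𝟙 (i ℕ.≟ r)) ≡ 0
    ∑-𝟙-≤ m r m≤r = trans
      (∑-cong-< m λ {i} i<m → 𝟙-false (i ℕ.≟ r) λ i≡r → ℕ.<⇒≢ (ℕ.≤-trans i<m m≤r) i≡r)
      (∑-zero (downFrom m) λ _ → refl)

    ∑-𝟙-< : ∀ m r → r < m → ∑ (downFrom m) (λ i → 𝟙 (i ℕ.≟ r)) ≡ 1
    ∑-𝟙-< (suc m) r (s≤s r≤m) with m ℕ.≟ r
    ... | yes refl = cong suc (∑-𝟙-≤ m m ℕ.≤-refl)
    ... | no m≢r   = ∑-𝟙-< m r (ℕ.≤∧≢⇒< r≤m (m≢r ∘ sym))

    ∑-∷ : ∀ (x : A) xs f → ∑ (x ∷ xs) f ≡ f x + ∑ xs f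
    ∑-∷ x xs f = refl

    ∑-1 : ∀ (x : A) f → ∑ (x ∷ []) f ≡ f x
    ∑-1 x f = ℕ.+-identityʳ (f x)

    ∑-2 : ∀ (x y : A) f → ∑ (x ∷ y ∷ []) f ≡ f x + f y
    ∑-2 x y f = cong (f x +_) (∑-1 y f)

    ∑-3 : ∀ (x y z : A) f → ∑ (x ∷ y ∷ z ∷ []) f ≡ f x + (f y + f z)
    ∑-3 x y z f = cong (f x +_) (∑-2 y z f)

    ∑-cong-All : ∀ {xs : List A} {f g} → All (λ x → f x ≡ g x) xs → ∑ xs f ≡ ∑ xs g
    ∑-cong-All []         = refl
    ∑-cong-All (eq ∷ eqs) = cong₂ ℕ._+_ eq (∑-cong-All eqs)

    ∑-replicate : ∀ k (x : A) f → ∑ (replicate k x) f ≡ k ℕ.* f x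
    ∑-replicate zero    x f = refl
    ∑-replicate (suc k) x f = cong (f x ℕ.+_) (∑-replicate k x f)

  ∑-lookup : ∀ {A : Set} (xs : List A) f → ∑ (allFin (length xs)) (f ∘ lookup xs) ≡ ∑ xs f
  ∑-lookup xs f = trans (sym (∑-map (lookup xs) (allFin (length xs)) f))
    (cong (λ ys → ∑ ys f) (trans (List.map-tabulate id (lookup xs)) (List.tabulate-lookup xs)))

  opaque
    unfolding ∑

    ∑-allFin : ∀ {m} (i : Fin m) → ∑ (allFin m) (λ j → 𝟙 (i ≟ j)) ≡ 1
    ∑-allFin {suc m} i = trans (cong (λ xs → 𝟙 (i ≟ zero) ℕ.+ ∑ xs (λ j → 𝟙 (i ≟ j))) (sym (List.map-tabulate id suc)))
      (trans (cong (𝟙 (i ≟ zero) ℕ.+_) (∑-map suc (allFin m) _)) (go i))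
      where
      go : ∀ {m} (i : Fin (suc m)) → 𝟙 (i ≟ zero) ℕ.+ ∑ (allFin m) (λ j → 𝟙 (i ≟ suc j)) ≡ 1
      go {m} zero = cong suc (∑-zero (allFin m) λ j → refl)
      go {m} (suc i) = trans (∑-cong (allFin m) λ j → 𝟙-cong (suc i ≟ suc j) (i ≟ j) Fin.suc-injective (cong suc)) (∑-allFin i)

open Summation

All-downFrom : ∀ m → All (ℕ._< m) (downFrom m)
All-downFrom m = All.applyDownFrom⁺₁ id m id

-- Counting pairs in lists of subsets

module SubsetCounting where

  open import Data.Nat using (_+_; _*_)

  private variable
    A : Set
    N : ℕ

  𝟙-× : ∀ {P Q : Set} (p? : Dec P) (q? : Dec Q) → 𝟙 (p? ×-dec q?) ≡ 𝟙 p? * 𝟙 q?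
  𝟙-× (yes p) (yes q) = refl
  𝟙-× (yes p) (no ¬q) = refl
  𝟙-× (no ¬p) q?      = refl

  opaque
    unfolding ∑

    length-filter-∑ : ∀ {P : A → Set} (P? : ∀ x → Dec (P x)) xs →
                      length (filter P? xs) ≡ ∑ xs (λ x → 𝟙 (P? x))
    length-filter-∑ P? []       = refl
    length-filter-∑ P? (x ∷ xs) with P? x
    ... | yes _ = cong suc (length-filter-∑ P? xs)
    ... | no  _ = length-filter-∑ P? xs

  pairCount-∑ : ∀ (f : A → Subset N) xs x y →
                pairCount (map f xs) x y ≡ ∑ xs (λ a → 𝟙 (x ∈? f a) * 𝟙 (y ∈? f a))
  pairCount-∑ f xs x y = trans (length-filter-∑ _ (map f xs))
    (trans (∑-map f xs _) (∑-cong xs λ a → 𝟙-× (x ∈? f a) (y ∈? f a)))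

  𝟙-∪⁅⁆ : ∀ {p} (S : Subset N) x → p ∉ S → 𝟙 (x ∈? (S ∪ ⁅ p ⁆)) ≡ 𝟙 (x ∈? S) + 𝟙 (x ≟ p)
  𝟙-∪⁅⁆ {p = p} S x p∉S with x ∈? S | x ≟ p
  ... | yes x∈S | yes refl = contradiction x∈S p∉S
  ... | yes x∈S | no  _    = 𝟙-true (x ∈? _) (x∈p∪q⁺ (inj₁ x∈S))
  ... | no  _   | yes refl = 𝟙-true (x ∈? _) (x∈p∪q⁺ (inj₂ (x∈⁅x⁆ x)))
  ... | no  x∉S | no  x≢p  = 𝟙-false (x ∈? _) ([ x∉S , x≢p ∘ x∈⁅y⁆⇒x≡y p ]′ ∘ x∈p∪q⁻ S ⁅ p ⁆)

  ∣∪⁅⁆∣ : ∀ {p} (S : Subset N) → p ∉ S → ∣ S ∪ ⁅ p ⁆ ∣ ≡ suc ∣ S ∣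
  ∣∪⁅⁆∣ {p = zero}  (inside  ∷ S) p∉S = contradiction here p∉S
  ∣∪⁅⁆∣ {p = zero}  (outside ∷ S) p∉S = cong (suc ∘ ∣_∣) (trans (∪-comm S ⊥) (∪-identityˡ S))
  ∣∪⁅⁆∣ {p = suc p} (inside  ∷ S) p∉S = cong suc (∣∪⁅⁆∣ S (p∉S ∘ there))
  ∣∪⁅⁆∣ {p = suc p} (outside ∷ S) p∉S = ∣∪⁅⁆∣ S (p∉S ∘ there)

  -- Points are adjoined on the right, in the form used by `augment`, so that `𝟙-∪⁅⁆` and `∣∪⁅⁆∣`
  -- serve both the triples and their augmentations.
  fromList : List (Fin N) → Subset N
  fromList = foldr (λ p S → S ∪ ⁅ p ⁆) ⊥

  ∉-fromList : ∀ {x : Fin N} {ps} → All (x ≢_) ps → x ∉ fromList ps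
  ∉-fromList []           = ∉⊥
  ∉-fromList {ps = p ∷ ps} (x≢p ∷ x≢ps) =
    [ ∉-fromList x≢ps , x≢p ∘ x∈⁅y⁆⇒x≡y p ]′ ∘ x∈p∪q⁻ (fromList ps) ⁅ p ⁆

  ∈-fromList⁻ : ∀ {P : Fin N → Set} {x ps} → All P ps → x ∈ fromList ps → P x
  ∈-fromList⁻ []           x∈ = contradiction x∈ ∉⊥
  ∈-fromList⁻ {P = P} {ps = p ∷ ps} (Pp ∷ Pps) x∈ with x∈p∪q⁻ (fromList ps) ⁅ p ⁆ x∈
  ... | inj₁ x∈ps = ∈-fromList⁻ Pps x∈ps
  ... | inj₂ x∈p  = subst P (sym (x∈⁅y⁆⇒x≡y p x∈p)) Pp

  opaque
    unfolding ∑

    𝟙-fromList : ∀ {ps : List (Fin N)} x → Unique ps →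
                 𝟙 (x ∈? fromList ps) ≡ ∑ ps (λ p → 𝟙 (x ≟ p))
    𝟙-fromList {ps = []}     x []      = 𝟙-false (x ∈? ⊥) ∉⊥
    𝟙-fromList {ps = p ∷ ps} x (p≢ ∷ u) =
      trans (𝟙-∪⁅⁆ (fromList ps) x (∉-fromList p≢))
            (trans (cong (_+ 𝟙 (x ≟ p)) (𝟙-fromList x u)) (ℕ.+-comm _ (𝟙 (x ≟ p))))

  ∣fromList∣ : ∀ {ps : List (Fin N)} → Unique ps → ∣ fromList ps ∣ ≡ length ps
  ∣fromList∣ {N = N} []       = ∣⊥∣≡0 N
  ∣fromList∣ (p≢ ∷ u) = trans (∣∪⁅⁆∣ _ (∉-fromList p≢)) (cong suc (∣fromList∣ u))

  -- Recursion on the list turns a nesting given on labels into one given on positions, with no cast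
  -- between `length (map f xs)` and `length xs`.
  transport : ∀ (f : A → Subset N) (φ : A → Fin N) xs → Fin (length (map f xs)) → Fin N
  transport f φ (x ∷ xs) zero    = φ x
  transport f φ (x ∷ xs) (suc i) = transport f φ xs i

  augment-map : ∀ (f : A → Subset N) φ xs →
                augment (map f xs) (transport f φ xs) ≡ map (λ a → f a ∪ ⁅ φ a ⁆) xs
  augment-map f φ []       = refl
  augment-map f φ (x ∷ xs) = cong (_ ∷_) (augment-map f φ xs)

  transport-All : ∀ (f : A → Subset N) (φ : A → Fin N) (R : Fin N → Subset N → Set) {xs} →
                  All (λ a → R (φ a) (f a)) xs →
                  ∀ i → R (transport f φ xs i) (lookup (map f xs) i)
  transport-All f φ R (r ∷ rs) zero    = r
  transport-All f φ R (r ∷ rs) (suc i) = transport-All f φ R rs i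

  ∈-++⊥ : ∀ {m k} (i : Fin m) → (i ↑ˡ k) ∈ (⊤ {m} Vec.++ ⊥ {k})
  ∈-++⊥ zero    = here
  ∈-++⊥ (suc i) = there (∈-++⊥ i)

  ∉-++⊥ : ∀ m {k} (i : Fin k) → (m ↑ʳ i) ∉ (⊤ {m} Vec.++ ⊥ {k})
  ∉-++⊥ zero    i i∈         = ∉⊥ i∈
  ∉-++⊥ (suc m) i (there i∈) = ∉-++⊥ m i i∈

  ∣⊤++⊥∣ : ∀ m {k} → ∣ ⊤ {m} Vec.++ ⊥ {k} ∣ ≡ m
  ∣⊤++⊥∣ zero {k} = ∣⊥∣≡0 k
  ∣⊤++⊥∣ (suc m)  = cong suc (∣⊤++⊥∣ m)

open SubsetCounting

open import Data.Integer as ℤ using (ℤ; +_)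
import Data.Integer.Properties as ℤ
open import Data.Integer.DivMod using (_%ℕ_; _/ℕ_; n%ℕd<d; a≡a%ℕn+[a/ℕn]*n)
open import Data.Integer.Divisibility.Signed
  using (_∣_; _∣?_; divides; ∣⇒∣ᵤ; ∣m∣n⇒∣m+n; ∣m∣n⇒∣m-n; ∣m⇒∣-m; ∣n⇒∣m*n)
open import Data.Integer.Tactic.RingSolver using (solve-∀)

-- Congruence indicators and complete residue systems

module Residues where

  open import Data.Integer using (_+_; _-_; _*_; -_)

  opaque
    D : ℕ → ℤ → ℕ
    D m z = 𝟙 (+ m ∣? z)

    D-𝟙 : ∀ m z → D m z ≡ 𝟙 (+ m ∣? z)
    D-𝟙 m z = refl

    D-false : ∀ {m z} → ¬ (+ m ∣ z) → D m z ≡ 0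
    D-false = 𝟙-false (+ _ ∣? _)

    D-⇔ : ∀ {m k a b} → (+ m ∣ a → + k ∣ b) → (+ k ∣ b → + m ∣ a) → D m a ≡ D k b
    D-⇔ = 𝟙-cong (+ _ ∣? _) (+ _ ∣? _)

  module _ {m : ℕ} where

    D-mod : ∀ a b → + m ∣ a - b → D m a ≡ D m b
    D-mod a b m∣a-b = D-⇔
      (λ m∣a → subst (+ m ∣_) (lemma₁ a b) (∣m∣n⇒∣m-n m∣a m∣a-b))
      (λ m∣b → subst (+ m ∣_) (lemma₂ a b) (∣m∣n⇒∣m+n m∣a-b m∣b))
      where
      lemma₁ : ∀ a b → a - (a - b) ≡ b
      lemma₁ = solve-∀
      lemma₂ : ∀ a b → a - b + b ≡ a
      lemma₂ = solve-∀

    D-shift : ∀ a b k → a - b ≡ k * + m → D m a ≡ D m b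
    D-shift a b k eq = D-mod a b (divides k eq)

    D-neg : ∀ a → D m (- a) ≡ D m a
    D-neg a = D-⇔
      (λ d → subst (+ m ∣_) (ℤ.neg-involutive a) (∣m⇒∣-m d)) ∣m⇒∣-m

    D-flip : ∀ a b → D m (a - b) ≡ D m (b - a)
    D-flip a b = trans (sym (D-neg (a - b))) (cong (D m) (lemma a b))
      where
      lemma : ∀ a b → - (a - b) ≡ b - a
      lemma = solve-∀

    D-≤1 : ∀ a → D m a ℕ.≤ 1
    D-≤1 a rewrite D-𝟙 m a with + m ∣? a
    ... | yes _ = ℕ.≤-refl
    ... | no  _ = ℕ.z≤n

    -- Wherever the first factor is nonzero, `a` vanishes modulo `m`.
    D-*D : ∀ a b → D m a ℕ.* D m b ≡ D m a ℕ.* D m (b - a)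
    D-*D a b with + m ∣? a
    ... | no  ¬d  rewrite D-false ¬d = refl
    ... | yes m∣a = cong (D m a ℕ.*_) (D-mod b (b - a) (subst (+ m ∣_) (lemma a b) m∣a))
      where
      lemma : ∀ a b → a ≡ b - (b - a)
      lemma = solve-∀

  -- The difference has absolute value below `m`, and only 0 is a multiple of `m` in that range.
  residue-unique : ∀ m {r s} → r ℕ.< m → s ℕ.< m → + m ∣ + r - + s → r ≡ s
  residue-unique m {r} {s} r<m s<m d = ℤ.+-injective (ℤ.i-j≡0⇒i≡j (+ r) (+ s) (ℤ.∣i∣≡0⇒i≡0 small))
    where
    bound : ℤ.∣ + r - + s ∣ ℕ.< m
    bound = subst (λ z → ℤ.∣ z ∣ ℕ.< m) (sym (ℤ.[+m]-[+n]≡m⊖n r s))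
              (ℕ.≤-<-trans (ℤ.∣m⊝n∣≤m⊔n r s) (ℕ.⊔-pres-<m r<m s<m))
    small : ℤ.∣ + r - + s ∣ ≡ 0
    small with ℤ.∣ + r - + s ∣ | bound | ∣⇒∣ᵤ d
    ... | zero  | _ | _  = refl
    ... | suc k | b | d′ = contradiction d′ (ℕ.>⇒∤ b)

  module _ (m : ℕ) {{_ : NonZero m}} where

    ∣-a%m : ∀ a → + m ∣ a - + (a %ℕ m)
    ∣-a%m a = divides (a /ℕ m)
      (trans (cong (_- + (a %ℕ m)) (a≡a%ℕn+[a/ℕn]*n a m)) (lemma (+ (a %ℕ m)) _))
      where
      lemma : ∀ x y → x + y - x ≡ y
      lemma = solve-∀

    %ℕ-cong : ∀ a b → + m ∣ a - b → a %ℕ m ≡ b %ℕ m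
    %ℕ-cong a b d = residue-unique m (n%ℕd<d a m) (n%ℕd<d b m)
      (subst (+ m ∣_) (lemma a b _ _) (∣m∣n⇒∣m+n (∣m∣n⇒∣m-n d (∣-a%m a)) (∣-a%m b)))
      where
      lemma : ∀ a b r s → a - b - (a - r) + (b - s) ≡ r - s
      lemma = solve-∀

    %ℕ-cong⁻¹ : ∀ a b → a %ℕ m ≡ b %ℕ m → + m ∣ a - b
    %ℕ-cong⁻¹ a b eq = subst (+ m ∣_) (lemma a b _ _ (cong (+_) eq)) (∣m∣n⇒∣m-n (∣-a%m a) (∣-a%m b))
      where
      lemma′ : ∀ a b r → a - r - (b - r) ≡ a - b
      lemma′ = solve-∀
      lemma : ∀ a b r s → r ≡ s → a - r - (b - s) ≡ a - b
      lemma a b r .r refl = lemma′ a b r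

    ∑-residues : ∀ a → ∑ (downFrom m) (λ g → D m (a - + g)) ≡ 1
    ∑-residues a = trans
      (∑-cong-< m λ {g} g<m → trans (D-𝟙 m _) (𝟙-cong (+ m ∣? a - + g) (g ℕ.≟ a %ℕ m)
        (λ d → sym (residue-unique m (n%ℕd<d a m) g<m
          (subst (+ m ∣_) (lemma a (+ g) _) (∣m∣n⇒∣m-n d (∣-a%m a)))))
        (λ { refl → ∣-a%m a })))
      (∑-𝟙-< m (a %ℕ m) (n%ℕd<d a m))
      where
      lemma : ∀ a g r → a - g - (a - r) ≡ r - g
      lemma = solve-∀

    -- Counts the translations meeting two conditions at once: given the first, the second becomes
    -- independent of `g` by `D-*D`, and `∑-residues` counts the first.
    ∑-residues² : ∀ a b → ∑ (downFrom m) (λ g → D m (a - + g) ℕ.* D m (b - + g)) ≡ D m (b - a)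
    ∑-residues² a b = trans
      (∑-cong (downFrom m) λ g →
        trans (D-*D (a - + g) (b - + g)) (cong (λ z → D m (a - + g) ℕ.* D m z) (lemma a b (+ g))))
      (trans (∑-*ʳ (downFrom m) _ _)
             (trans (cong (ℕ._* D m (b - a)) (∑-residues a)) (ℕ.+-identityʳ _)))
      where
      lemma : ∀ a b g → b - g - (a - g) ≡ b - a
      lemma = solve-∀

  -- The residue count at `κ + 1`. It serves as a partition of unity over the level differences 0, 1
  -- and -1.
  ∑-D3 : ∀ κ → D 3 κ ℕ.+ (D 3 (κ - + 1) ℕ.+ D 3 (κ + + 1)) ≡ 1
  ∑-D3 κ = trans (sym (trans (∑-3 2 1 0 (λ i → D 3 (κ + + 1 - + i)))
      (trans (cong₂ ℕ._+_ (cong (D 3) (minus₂ κ)) (cong₂ ℕ._+_ (cong (D 3) (minus₁ κ)) (cong (D 3) (minus₀ κ))))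
             (rotate (D 3 (κ - + 1)) (D 3 κ) (D 3 (κ + + 1))))))
    (∑-residues 3 (κ + + 1))
    where
    minus₂ : ∀ κ → κ + + 1 - + 2 ≡ κ - + 1
    minus₂ = solve-∀
    minus₁ : ∀ κ → κ + + 1 - + 1 ≡ κ
    minus₁ = solve-∀
    minus₀ : ∀ κ → κ + + 1 - + 0 ≡ κ + + 1
    minus₀ = solve-∀
    rotate : ∀ p e q → p ℕ.+ (e ℕ.+ q) ≡ e ℕ.+ (p ℕ.+ q)
    rotate = ℕ-Solver.solve-∀

  module _ (m : ℕ) {{_ : NonZero m}} where

    residue : ℤ → Fin m
    residue a = fromℕ< (n%ℕd<d a m)

    residue-cong : ∀ a b → + m ∣ a - b → residue a ≡ residue b
    residue-cong a b d = Fin.fromℕ<-cong _ _ (%ℕ-cong m a b d) (n%ℕd<d a m) (n%ℕd<d b m)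

    residue-cong⁻¹ : ∀ a b → residue a ≡ residue b → + m ∣ a - b
    residue-cong⁻¹ a b eq = %ℕ-cong⁻¹ m a b (Fin.fromℕ<-injective _ _ (n%ℕd<d a m) (n%ℕd<d b m) eq)

    residue-surjective : ∀ (i : Fin m) → residue (+ toℕ i) ≡ i
    residue-surjective i = Fin.toℕ-injective (trans (Fin.toℕ-fromℕ< _)
      (sym (residue-unique m (Fin.toℕ<n i) (n%ℕd<d (+ toℕ i) m) (∣-a%m m (+ toℕ i)))))

open Residues

-- Centres and radii of the Bose triples

record Base : Set where
  constructor base
  field
    centre radius : ℤ

open Base

module Family (s : ℕ) where

  open import Data.Integer using (_+_; _-_; _*_; -_)

  t n : ℕ
  t = suc s
  n = suc (t ℕ.* 4)

  T : ℤ
  T = + t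

  -- The indices i and j of the two families are both `suc k`; thus 3j - 1 reads `2 + k * 3`, which
  -- shows that all radii are 0 or 2 modulo 3.
  near far : ℕ → Base
  near k = base (T - + suc k) (+ (suc k ℕ.* 3))
  far  k = base (T + + suc k) (+ (2 ℕ.+ k ℕ.* 3))

  internal : List Base
  internal = map near (downFrom s) ++ map far (downFrom t)

  -- Membership of `c` in the class ±d. As n is odd, the value 2 occurs only when both arguments
  -- vanish modulo n.
  W : ℤ → ℤ → ℕ
  W d c = D n (c - d) ℕ.+ D n (c + d)

  W-comm : ∀ d c → W d c ≡ W c d
  W-comm d c = cong₂ ℕ._+_ (D-flip c d) (cong (D n) (ℤ.+-comm c d))

  +n : + n ≡ + 1 + T * + 4
  +n = cong (λ z → + 1 + z) (ℤ.pos-* t 4)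

  -- The modulus is spelled out as a polynomial in `T`, so that a congruence with explicit quotient
  -- `k` becomes a ring identity.
  D-shift′ : ∀ a b k → a ≡ b + k * (+ 1 + T * + 4) → D n a ≡ D n b
  D-shift′ a b k eq = D-shift a b k
    (trans (cong (_- b) eq) (trans (lemma b _) (cong (k *_) (sym +n))))
    where
    lemma : ∀ b x → b + x - b ≡ x
    lemma = solve-∀

  η : ℤ
  η = + 1 + + 2 * T

  -- 2 η ≡ 1 modulo n.
  D-half : ∀ z → D n (η * z) ≡ D n z
  D-half z = D-⇔
    (λ d → subst (+ n ∣_) (trans (cong (λ m → + 2 * (η * z) - z * m) +n) (lemma T z))
             (∣m∣n⇒∣m-n (∣n⇒∣m*n (+ 2) d) (divides z refl)))
    (∣n⇒∣m*n η)
    where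
    lemma : ∀ T z → + 2 * ((+ 1 + + 2 * T) * z) - z * (+ 1 + T * + 4) ≡ z
    lemma = solve-∀

  D-small : ∀ {k} → suc k ℕ.< n → D n (+ suc k) ≡ 0
  D-small {k} k<n = D-false λ d → contradiction
    (residue-unique n k<n (s≤s z≤n) (subst (+ n ∣_) (sym (ℤ.+-identityʳ _)) d)) λ ()

  -- Adding `h = 2t` moves the symmetric range -2t, ..., 2t onto the standard residues 0, ..., 4t
  -- counted by `∑-residues`.
  window : ∀ c → D n c ℕ.+ (∑ (downFrom (t ℕ.* 2)) (λ k → D n (c - + suc k))
                        ℕ.+ ∑ (downFrom (t ℕ.* 2)) (λ k → D n (c + + suc k))) ≡ 1
  window c = begin
    D n c ℕ.+ (∑ H (λ k → D n (c - + suc k)) ℕ.+ ∑ H (λ k → D n (c + + suc k)))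
      ≡⟨ swap (D n c) (∑ H λ k → D n (c - + suc k)) (∑ H λ k → D n (c + + suc k)) ⟩
    ∑ H (λ k → D n (c + + suc k)) ℕ.+ (D n c ℕ.+ ∑ H (λ k → D n (c - + suc k)))
      ≡⟨ cong₂ ℕ._+_
           (∑-reverse h _ _ λ i j e → cong (D n) (lemma₁ c (+ suc i) (+ j) (+ h) (cong +_ (trans (sym (ℕ.+-suc i j)) e))))
           (cong₂ ℕ._+_ (trans (cong (D n) (trans (lemma₂ c (+ h)) (cong (λ x → c + + h - + x) (sym (ℕ.+-identityʳ h))))) (sym (∑-1 0 _)))
                        (∑-cong H λ k → cong (D n) (lemma₃ c (+ h) (+ suc k)))) ⟩
    ∑ H (λ g → D n (c + + h - + g)) ℕ.+
      (∑ (downFrom 1) (λ k → D n (c + + h - + (h ℕ.+ k))) ℕ.+ ∑ H (λ k → D n (c + + h - + (h ℕ.+ suc k))))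
      ≡⟨ cong (∑ H (λ g → D n (c + + h - + g)) ℕ.+_) (∑-split 1 h λ k → D n (c + + h - + (h ℕ.+ k))) ⟨
    ∑ H (λ g → D n (c + + h - + g)) ℕ.+ ∑ (downFrom (suc h)) (λ k → D n (c + + h - + (h ℕ.+ k)))
      ≡⟨ ∑-split h (suc h) _ ⟨
    ∑ (downFrom (h ℕ.+ suc h)) (λ g → D n (c + + h - + g))
      ≡⟨ cong (λ m → ∑ (downFrom m) (λ g → D n (c + + h - + g))) (count t) ⟩
    ∑ (downFrom n) (λ g → D n (c + + h - + g))
      ≡⟨ ∑-residues n (c + + h) ⟩
    1 ∎
    where
    open ≡-Reasoning
    h = t ℕ.* 2
    H = downFrom h
    swap : ∀ a b c → a ℕ.+ (b ℕ.+ c) ≡ c ℕ.+ (a ℕ.+ b)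
    swap = ℕ-Solver.solve-∀
    count : ∀ t → t ℕ.* 2 ℕ.+ suc (t ℕ.* 2) ≡ suc (t ℕ.* 4)
    count = ℕ-Solver.solve-∀
    lemma₁ : ∀ c i j h → i + j ≡ h → c + i ≡ c + h - j
    lemma₁ c i j .(i + j) refl = lemma c i j
      where
      lemma : ∀ c i j → c + i ≡ c + (i + j) - j
      lemma = solve-∀
    lemma₂ : ∀ c h → c ≡ c + h - h
    lemma₂ = solve-∀
    lemma₃ : ∀ c h k → c - k ≡ c + h - (h + k)
    lemma₃ = solve-∀

  ∑W : ∀ c → ∑ (downFrom (t ℕ.* 2)) (λ k → W (+ suc k) c) ℕ.+ D n c ≡ 1
  ∑W c = trans (ℕ.+-comm _ (D n c)) (trans (cong (D n c ℕ.+_) (∑-+ (downFrom (t ℕ.* 2)) _ _)) (window c))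

  ∑-internal : ∀ f → ∑ internal f ≡ ∑ (downFrom s) (f ∘ near) ℕ.+ ∑ (downFrom t) (f ∘ far)
  ∑-internal f = trans (∑-++ (map near (downFrom s)) _ f) (cong₂ ℕ._+_ (∑-map near (downFrom s) f) (∑-map far (downFrom t) f))

  -- Zero and the radii are distinct numbers below 3t: multiples of 3 from 0 on, and numbers that
  -- are 2 modulo 3. As 3t < n, they are distinct residues.
  packing : ∀ c → D n c ℕ.+ ∑ internal (λ b → D n (c - radius b)) ℕ.≤ 1
  packing c = begin
    D n c ℕ.+ ∑ internal (λ b → D n (c - radius b))
      ≡⟨ cong₂ ℕ._+_ (cong (D n) (sym (ℤ.+-identityʳ c))) (∑-internal _) ⟩
    f 0 ℕ.+ (∑ (downFrom s) (λ k → f (suc k ℕ.* 3)) ℕ.+ ∑ (downFrom t) (λ k → f (2 ℕ.+ k ℕ.* 3)))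
      ≡⟨ regroup (f 0) _ _ ⟩
    (f 0 ℕ.+ ∑ (downFrom s) (λ k → f (suc k ℕ.* 3))) ℕ.+ 0 ℕ.+ ∑ (downFrom t) (λ k → f (2 ℕ.+ k ℕ.* 3))
      ≡⟨ cong (λ x → x ℕ.+ ∑ (downFrom s) (λ k → f (suc k ℕ.* 3)) ℕ.+ 0 ℕ.+ ∑ (downFrom t) (λ k → f (2 ℕ.+ k ℕ.* 3))) (∑-1 0 (λ k → f (k ℕ.* 3))) ⟨
    (∑ (downFrom 1) (λ k → f (k ℕ.* 3)) ℕ.+ ∑ (downFrom s) (λ k → f (suc k ℕ.* 3))) ℕ.+ 0 ℕ.+ ∑ (downFrom t) (λ k → f (2 ℕ.+ k ℕ.* 3))
      ≡⟨ cong (λ x → x ℕ.+ 0 ℕ.+ ∑ (downFrom t) (λ k → f (2 ℕ.+ k ℕ.* 3))) (∑-split 1 s λ k → f (k ℕ.* 3)) ⟨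
    ∑ (downFrom t) (λ k → f (k ℕ.* 3)) ℕ.+ 0 ℕ.+ ∑ (downFrom t) (λ k → f (2 ℕ.+ k ℕ.* 3))
      -- The numbers that are 1 modulo 3 are not radii; the inserted 0 is enlarged to their sum,
      -- which completes the interval below 3t.
      ≤⟨ ℕ.+-monoˡ-≤ (∑ (downFrom t) (λ k → f (2 ℕ.+ k ℕ.* 3))) (ℕ.+-monoʳ-≤ (∑ (downFrom t) (λ k → f (k ℕ.* 3))) z≤n) ⟩
    ∑ (downFrom t) (λ k → f (k ℕ.* 3)) ℕ.+ ∑ (downFrom t) (λ k → f (1 ℕ.+ k ℕ.* 3)) ℕ.+ ∑ (downFrom t) (λ k → f (2 ℕ.+ k ℕ.* 3))
      ≡⟨ ∑-mod3 t f ⟨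
    ∑ (downFrom (t ℕ.* 3)) f
      ≤⟨ ℕ.m≤m+n _ _ ⟩
    ∑ (downFrom (t ℕ.* 3)) f ℕ.+ ∑ (downFrom (suc t)) (λ k → f (t ℕ.* 3 ℕ.+ k))
      ≡⟨ ∑-split (t ℕ.* 3) (suc t) f ⟨
    ∑ (downFrom (t ℕ.* 3 ℕ.+ suc t)) f
      ≡⟨ cong (λ m → ∑ (downFrom m) f) (count t) ⟩
    ∑ (downFrom n) f
      ≡⟨ ∑-residues n c ⟩
    1 ∎
    where
    open ℕ.≤-Reasoning
    f : ℕ → ℕ
    f k = D n (c - + k)
    regroup : ∀ a b c → a ℕ.+ (b ℕ.+ c) ≡ (a ℕ.+ b) ℕ.+ 0 ℕ.+ c
    regroup = ℕ-Solver.solve-∀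
    count : ∀ t → t ℕ.* 3 ℕ.+ suc t ≡ suc (t ℕ.* 4)
    count = ℕ-Solver.solve-∀

  multiplicity : ℤ → ℕ
  multiplicity c = ∑ internal (λ b → W (radius b) c)

  -- The two signs in `W` are controlled separately, by `packing` at `c` and at `- c`.
  multiplicity-bound : ∀ c → D n c ℕ.* 2 ℕ.+ multiplicity c ℕ.≤ 2
  multiplicity-bound c = begin
    D n c ℕ.* 2 ℕ.+ multiplicity c
      ≡⟨ cong (D n c ℕ.* 2 ℕ.+_) (∑-+ internal _ _) ⟩
    D n c ℕ.* 2 ℕ.+ (∑ internal (λ b → D n (c - radius b)) ℕ.+ ∑ internal (λ b → D n (c + radius b)))
      ≡⟨ regroup (D n c) _ _ ⟩
    (D n c ℕ.+ ∑ internal (λ b → D n (c - radius b))) ℕ.+ (D n c ℕ.+ ∑ internal (λ b → D n (c + radius b)))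
      ≡⟨ cong ((D n c ℕ.+ ∑ internal (λ b → D n (c - radius b))) ℕ.+_)
           (cong₂ ℕ._+_ (sym (D-neg c)) (∑-cong internal λ b → trans (sym (D-neg (c + radius b))) (cong (D n) (lemma c (radius b))))) ⟩
    (D n c ℕ.+ ∑ internal (λ b → D n (c - radius b))) ℕ.+ (D n (- c) ℕ.+ ∑ internal (λ b → D n (- c - radius b)))
      ≤⟨ ℕ.+-mono-≤ (packing c) (packing (- c)) ⟩
    2 ∎
    where
    open ℕ.≤-Reasoning
    regroup : ∀ a b c → a ℕ.* 2 ℕ.+ (b ℕ.+ c) ≡ (a ℕ.+ b) ℕ.+ (a ℕ.+ c)
    regroup = ℕ-Solver.solve-∀
    lemma : ∀ c d → - (c + d) ≡ - c - d
    lemma = solve-∀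

  multiplicity-cong : ∀ a b → + n ∣ a - b → multiplicity a ≡ multiplicity b
  multiplicity-cong a b d = ∑-cong internal λ x → cong₂ ℕ._+_
    (D-mod (a - radius x) (b - radius x) (subst (+ n ∣_) (lemma₁ a b (radius x)) d))
    (D-mod (a + radius x) (b + radius x) (subst (+ n ∣_) (lemma₂ a b (radius x)) d))
    where
    lemma₁ : ∀ a b r → a - b ≡ a - r - (b - r)
    lemma₁ = solve-∀
    lemma₂ : ∀ a b r → a - b ≡ a + r - (b + r)
    lemma₂ = solve-∀

  multiplicity-neg : ∀ a → multiplicity (- a) ≡ multiplicity a
  multiplicity-neg a = ∑-cong internal λ x → trans (ℕ.+-comm (D n (- a - radius x)) _) (cong₂ ℕ._+_
    (trans (sym (D-neg _)) (cong (D n) (lemma₁ a (radius x))))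
    (trans (sym (D-neg _)) (cong (D n) (lemma₂ a (radius x)))))
    where
    lemma₁ : ∀ a r → - (- a + r) ≡ a - r
    lemma₁ = solve-∀
    lemma₂ : ∀ a r → - (- a - r) ≡ a + r
    lemma₂ = solve-∀

  D-transfer : ∀ (f : ℤ → ℕ) a b → (+ n ∣ a - b → f a ≡ f b) → f b ℕ.* D n (a - b) ≡ f a ℕ.* D n (a - b)
  D-transfer f a b eq with + n ∣? (a - b)
  ... | yes d = cong (ℕ._* D n (a - b)) (sym (eq d))
  ... | no ¬d rewrite D-false ¬d = trans (ℕ.*-zeroʳ (f b)) (sym (ℕ.*-zeroʳ (f a)))

  -- Every nonzero residue is ± one of 1, …, 2t, exactly once.
  ∑-classes : ∀ (f : ℤ → ℕ) → (∀ a b → + n ∣ a - b → f a ≡ f b) → (∀ a → f (- a) ≡ f a) →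
              ∀ c → ∑ (downFrom (t ℕ.* 2)) (λ k → f (+ suc k) ℕ.* W (+ suc k) c) ℕ.+ f c ℕ.* D n c ≡ f c
  ∑-classes f f-cong f-neg c = begin
    ∑ (downFrom (t ℕ.* 2)) (λ k → f (+ suc k) ℕ.* W (+ suc k) c) ℕ.+ f c ℕ.* D n c
      ≡⟨ cong (ℕ._+ f c ℕ.* D n c) (∑-cong (downFrom (t ℕ.* 2)) λ k → step (+ suc k)) ⟩
    ∑ (downFrom (t ℕ.* 2)) (λ k → f c ℕ.* W (+ suc k) c) ℕ.+ f c ℕ.* D n c
      ≡⟨ cong (ℕ._+ f c ℕ.* D n c) (∑-*ˡ (f c) (downFrom (t ℕ.* 2)) _) ⟩
    f c ℕ.* ∑ (downFrom (t ℕ.* 2)) (λ k → W (+ suc k) c) ℕ.+ f c ℕ.* D n c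
      ≡⟨ ℕ.*-distribˡ-+ (f c) _ (D n c) ⟨
    f c ℕ.* (∑ (downFrom (t ℕ.* 2)) (λ k → W (+ suc k) c) ℕ.+ D n c)
      ≡⟨ cong (f c ℕ.*_) (∑W c) ⟩
    f c ℕ.* 1
      ≡⟨ ℕ.*-identityʳ (f c) ⟩
    f c ∎
    where
    open ≡-Reasoning
    neg-neg : ∀ c k → c - (- k) ≡ c + k
    neg-neg = solve-∀
    -- A nonzero `W k c` means that `c` is congruent to k or to -k. Periodicity of `f` settles the
    -- first case, and evenness reduces the second to it.
    step : ∀ k → f k ℕ.* W k c ≡ f c ℕ.* W k c
    step k = begin
      f k ℕ.* W k c                                    ≡⟨ ℕ.*-distribˡ-+ (f k) _ _ ⟩
      f k ℕ.* D n (c - k) ℕ.+ f k ℕ.* D n (c + k)      ≡⟨ cong₂ ℕ._+_ (D-transfer f c k (f-cong c k))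
                                                            (cong₂ ℕ._*_ (sym (f-neg k)) (cong (D n) (sym (neg-neg c k)))) ⟩
      f c ℕ.* D n (c - k) ℕ.+ f (- k) ℕ.* D n (c - (- k))  ≡⟨ cong (f c ℕ.* D n (c - k) ℕ.+_) (D-transfer f c (- k) (f-cong c (- k))) ⟩
      f c ℕ.* D n (c - k) ℕ.+ f c ℕ.* D n (c - (- k))  ≡⟨ cong (λ z → f c ℕ.* D n (c - k) ℕ.+ f c ℕ.* D n z) (neg-neg c k) ⟩
      f c ℕ.* D n (c - k) ℕ.+ f c ℕ.* D n (c + k)      ≡⟨ ℕ.*-distribˡ-+ (f c) _ _ ⟨
      f c ℕ.* W k c                                    ∎

  -- Tops up the class of `suc k` to two occurrences; the truncated subtraction is exact by
  -- `multiplicity-bound`.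
  copies : ℕ → List ℤ
  copies k = replicate (2 ℕ.∸ multiplicity (+ suc k)) (+ suc k)

  external : List ℤ
  external = concatMap copies (downFrom (t ℕ.* 2))

  ∑-external : ∀ f → ∑ external f ≡ ∑ (downFrom (t ℕ.* 2)) (λ k → (2 ℕ.∸ multiplicity (+ suc k)) ℕ.* f (+ suc k))
  ∑-external f = trans (∑-concatMap copies (downFrom (t ℕ.* 2)) f)
    (∑-cong (downFrom (t ℕ.* 2)) λ k → ∑-replicate (2 ℕ.∸ multiplicity (+ suc k)) (+ suc k) f)

  -- For nonzero `c` the top-up makes the total exactly two. At zero, the bound forces the internal
  -- part to vanish, and then `∑-classes` forces the external part to vanish too.
  two-fold : ∀ c → D n c ℕ.* 2 ℕ.+ (multiplicity c ℕ.+ ∑ external (λ d → W d c)) ≡ 2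
  two-fold c = final (D-≤1 c) (multiplicity-bound c) classes
    where
    classes : ∑ external (λ d → W d c) ℕ.+ (2 ℕ.∸ multiplicity c) ℕ.* D n c ≡ 2 ℕ.∸ multiplicity c
    classes = trans (cong (ℕ._+ (2 ℕ.∸ multiplicity c) ℕ.* D n c) (∑-external λ d → W d c))
      (∑-classes (λ c → 2 ℕ.∸ multiplicity c) (λ a b d → cong (2 ℕ.∸_) (multiplicity-cong a b d)) (λ a → cong (2 ℕ.∸_) (multiplicity-neg a)) c)
    final : ∀ {δ f e} → δ ℕ.≤ 1 → δ ℕ.* 2 ℕ.+ f ℕ.≤ 2 → e ℕ.+ (2 ℕ.∸ f) ℕ.* δ ≡ 2 ℕ.∸ f → δ ℕ.* 2 ℕ.+ (f ℕ.+ e) ≡ 2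
    final {zero} {f} {e} _ f≤2 eq = trans
      (cong (f ℕ.+_) (trans (sym (trans (cong (e ℕ.+_) (ℕ.*-zeroʳ (2 ℕ.∸ f))) (ℕ.+-identityʳ e))) eq))
      (ℕ.m+[n∸m]≡n f≤2)
    final {suc zero} {zero} {zero}  _ _ _  = refl
    final {suc zero} {zero} {suc e} _ _ eq = contradiction (trans (cong suc (ℕ.+-comm 2 e)) eq) λ ()
    final {suc zero} {suc f} _ (s≤s (s≤s ())) _
    final {suc (suc δ)} (s≤s ()) _ _

  -- A nonzero radius separates the two points on level 0; a nonzero centre keeps the nesting point
  -- (0 , 1) off the triple.
  internal-proper : All (λ b → D n (radius b) ≡ 0 × D n (centre b) ≡ 0) internal
  internal-proper = All.++⁺
    (All.map⁺ (All.map (λ {k} k<s → D-small (s≤s (near-radius k<s)) ,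
       D-false λ d → ℕ.<⇒≢ (s≤s k<s) (sym (residue-unique n (s≤s t≤t*4) (s≤s (ℕ.≤-trans (ℕ.m<n⇒m<1+n k<s) t≤t*4)) d)))
       (All-downFrom s)))
    (All.map⁺ (All.map (λ {k} k<t → D-small (s≤s (far-radius k<t)) , D-small (s≤s (far-centre k<t))) (All-downFrom t)))
    where
    open ℕ.≤-Reasoning
    t≤t*4 : t ℕ.≤ t ℕ.* 4
    t≤t*4 = ℕ.m≤m*n t 4
    t*3≤ : t ℕ.* 3 ℕ.≤ t ℕ.* 4
    t*3≤ = ℕ.*-monoʳ-≤ t (ℕ.n≤1+n 3)
    near-radius : ∀ {k} → k ℕ.< s → suc k ℕ.* 3 ℕ.≤ t ℕ.* 4
    near-radius {k} k<s = ℕ.≤-trans (ℕ.*-monoˡ-≤ 3 (ℕ.m<n⇒m<1+n k<s)) t*3≤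
    far-radius : ∀ {k} → k ℕ.< t → 2 ℕ.+ k ℕ.* 3 ℕ.≤ t ℕ.* 4
    far-radius {k} k<t = ℕ.≤-trans (ℕ.≤-trans (ℕ.n≤1+n _) (ℕ.*-monoˡ-≤ 3 k<t)) t*3≤
    far-centre : ∀ {k} → k ℕ.< t → t ℕ.+ suc k ℕ.≤ t ℕ.* 4
    far-centre {k} k<t = begin
      t ℕ.+ suc k ≤⟨ ℕ.+-monoʳ-≤ t k<t ⟩
      t ℕ.+ t     ≤⟨ ℕ.m≤m+n _ (t ℕ.+ t) ⟩
      t ℕ.+ t ℕ.+ (t ℕ.+ t) ≡⟨ four t ⟩
      t ℕ.* 4     ∎
      where
      four : ∀ t → t ℕ.+ t ℕ.+ (t ℕ.+ t) ≡ t ℕ.* 4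
      four = ℕ-Solver.solve-∀

  external-proper : All (λ d → D n d ≡ 0) external
  external-proper = All.concat⁺ (All.map⁺ {f = copies} (All.map
    (λ {k} k<h → All.replicate⁺ (2 ℕ.∸ multiplicity (+ suc k)) (D-small (s≤s (ℕ.≤-trans k<h (ℕ.*-monoʳ-≤ t (s≤s (s≤s z≤n)))))))
    (All-downFrom (t ℕ.* 2))))

  -- Double counting: the 2t classes offer 4t places, and the 2t - 1 internal radii occupy one place
  -- each.
  length-external : length external ≡ suc (t ℕ.* 2)
  length-external = ℕ.+-cancelʳ-≡ (s ℕ.+ t) (length external) _ (begin
    length external ℕ.+ (s ℕ.+ t)
      ≡⟨ cong₂ ℕ._+_ (trans (sym (∑-one external)) (∑-external _)) (sym total) ⟩
    ∑ H (λ k → (2 ℕ.∸ multiplicity (+ suc k)) ℕ.* 1) ℕ.+ ∑ H (λ k → multiplicity (+ suc k))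
      ≡⟨ ∑-+ H _ _ ⟨
    ∑ H (λ k → (2 ℕ.∸ multiplicity (+ suc k)) ℕ.* 1 ℕ.+ multiplicity (+ suc k))
      ≡⟨ ∑-cong H (λ k → trans (cong (ℕ._+ multiplicity (+ suc k)) (ℕ.*-identityʳ _))
           (ℕ.m∸n+n≡m (ℕ.m+n≤o⇒n≤o (D n (+ suc k) ℕ.* 2) (multiplicity-bound (+ suc k))))) ⟩
    ∑ H (λ k → 2 ℕ.* 1)
      ≡⟨ ∑-*ˡ 2 H (λ _ → 1) ⟩
    2 ℕ.* ∑ H (λ _ → 1)
      ≡⟨ cong (2 ℕ.*_) (trans (∑-one H) (List.length-downFrom (t ℕ.* 2))) ⟩
    2 ℕ.* (t ℕ.* 2)
      ≡⟨ count s ⟩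
    suc (t ℕ.* 2) ℕ.+ (s ℕ.+ t) ∎)
    where
    open ≡-Reasoning
    H = downFrom (t ℕ.* 2)
    count : ∀ s → 2 ℕ.* (suc s ℕ.* 2) ≡ suc (suc s ℕ.* 2) ℕ.+ (s ℕ.+ suc s)
    count = ℕ-Solver.solve-∀
    -- With the sums exchanged, each internal radius is counted over the classes; being nonzero, it
    -- lies in exactly one.
    total : ∑ H (λ k → multiplicity (+ suc k)) ≡ s ℕ.+ t
    total = begin
      ∑ H (λ k → multiplicity (+ suc k))
        ≡⟨ ∑-swap H internal (λ k b → W (radius b) (+ suc k)) ⟩
      ∑ internal (λ b → ∑ H (λ k → W (radius b) (+ suc k)))
        ≡⟨ ∑-cong-All (All.map (λ {b} p → trans (∑-cong H λ k → W-comm (radius b) (+ suc k))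
             (trans (sym (trans (cong (∑ H (λ k → W (+ suc k) (radius b)) ℕ.+_) (proj₁ p)) (ℕ.+-identityʳ _))) (∑W (radius b)))) internal-proper) ⟩
      ∑ internal (λ _ → 1)
        ≡⟨ ∑-internal (λ _ → 1) ⟩
      ∑ (downFrom s) (λ _ → 1) ℕ.+ ∑ (downFrom t) (λ _ → 1)
        ≡⟨ cong₂ ℕ._+_ (trans (∑-one (downFrom s)) (List.length-downFrom s)) (trans (∑-one (downFrom t)) (List.length-downFrom t)) ⟩
      s ℕ.+ t ∎

  t*2≡ : t ℕ.* 2 ≡ s ℕ.+ suc t
  t*2≡ = lemma s
    where
    lemma : ∀ s → suc s ℕ.* 2 ≡ s ℕ.+ suc (suc s)
    lemma = ℕ-Solver.solve-∀

  -- With `f k` standing for the value k + 1, this cuts 1, ..., 2t into the part below t, t itself,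
  -- and the part above. The middle value is the one that the internal triples leave out in both
  -- star counts.
  ∑-thirds : ∀ f → ∑ (downFrom (t ℕ.* 2)) f
           ≡ ∑ (downFrom s) f ℕ.+ (f s ℕ.+ ∑ (downFrom t) (λ k → f (s ℕ.+ suc k)))
  ∑-thirds f = trans (cong (λ m → ∑ (downFrom m) f) t*2≡) (trans (∑-split s (suc t) f)
    (cong (∑ (downFrom s) f ℕ.+_) (trans (∑-split 1 t λ k → f (s ℕ.+ k))
      (cong (ℕ._+ ∑ (downFrom t) (λ k → f (s ℕ.+ suc k)))
        (trans (∑-1 0 λ k → f (s ℕ.+ k)) (cong f (ℕ.+-identityʳ s)))))))

  difference : ∀ a b {m} → a ℕ.+ b ≡ m → + m - + a ≡ + b
  difference a b refl = lemma (+ a) (+ b)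
    where
    lemma : ∀ a b → a + b - a ≡ b
    lemma = solve-∀

  pure-star : ∀ c → ∑ internal (λ b → W (centre b) c) ℕ.≤ 1
  pure-star c = begin
    ∑ internal (λ b → W (centre b) c)
      ≡⟨ ∑-internal _ ⟩
    ∑ (downFrom s) (λ k → W (T - + suc k) c) ℕ.+ far-sum
      ≡⟨ cong (ℕ._+ far-sum) (∑-reverse s (λ k → W (T - + suc k) c) (λ k → W (+ suc k) c)
           λ i j e → cong (λ z → W z c) (difference (suc i) (suc j) (cong suc e))) ⟩
    ∑ (downFrom s) (λ k → W (+ suc k) c) ℕ.+ far-sum
      -- `suc s` is t, and ±t is the only class containing no centre; its term is the slack.
      ≤⟨ ℕ.+-monoʳ-≤ (∑ (downFrom s) (λ k → W (+ suc k) c)) (ℕ.m≤n+m far-sum (W (+ suc s) c)) ⟩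
    ∑ (downFrom s) (λ k → W (+ suc k) c) ℕ.+ (W (+ suc s) c ℕ.+ far-sum)
      ≡⟨ ∑-thirds (λ k → W (+ suc k) c) ⟨
    ∑ (downFrom (t ℕ.* 2)) (λ k → W (+ suc k) c)
      ≤⟨ ℕ.m≤m+n _ (D n c) ⟩
    ∑ (downFrom (t ℕ.* 2)) (λ k → W (+ suc k) c) ℕ.+ D n c
      ≡⟨ ∑W c ⟩
    1 ∎
    where
    open ℕ.≤-Reasoning
    far-sum = ∑ (downFrom t) (λ k → W (+ suc (s ℕ.+ suc k)) c)

  -- Here `y` is a representative of half of `z` modulo n, and `k` is the quotient for which the
  -- identity becomes polynomial.
  D-halve : ∀ z y k → η * z ≡ y + k * (+ 1 + T * + 4) → D n z ≡ D n y
  D-halve z y k eq = trans (sym (D-half z)) (D-shift′ (η * z) y k eq)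

  +suc*3 : ∀ k → + (suc k ℕ.* 3) ≡ + suc k * + 3
  +suc*3 k = ℤ.pos-* (suc k) 3

  -- Halving the differences c + t + 2 u turns them into all of e ± 1, …, e ± 2t.
  mixed-star : ∀ c → ∑ internal (λ b → D n (c + (centre b + radius b)) ℕ.+ D n (c + (centre b - radius b)))
                     ℕ.+ (D n (c - T * + 3) ℕ.+ D n (c + T * + 3)) ℕ.≤ 1
  mixed-star c = begin
    ∑ internal (λ b → D n (c + (centre b + radius b)) ℕ.+ D n (c + (centre b - radius b)))
      ℕ.+ (D n (c - T * + 3) ℕ.+ D n (c + T * + 3))
      ≡⟨ cong₂ ℕ._+_ (trans (∑-internal _) (cong₂ ℕ._+_ (∑-+ (downFrom s) _ _) (∑-+ (downFrom t) _ _))) refl ⟩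
    (∑ (downFrom s) (λ k → D n (c + (T - + suc k + + (suc k ℕ.* 3)))) ℕ.+ ∑ (downFrom s) (λ k → D n (c + (T - + suc k - + (suc k ℕ.* 3))))
      ℕ.+ (∑ (downFrom t) (λ k → D n (c + (T + + suc k + + (2 ℕ.+ k ℕ.* 3)))) ℕ.+ ∑ (downFrom t) (λ k → D n (c + (T + + suc k - + (2 ℕ.+ k ℕ.* 3))))))
      ℕ.+ (D n (c - T * + 3) ℕ.+ D n (c + T * + 3))
      ≡⟨ cong₂ ℕ._+_ (cong₂ ℕ._+_
           (cong₂ ℕ._+_ (∑-cong (downFrom s) near⁺) (∑-cong (downFrom s) near⁻))
           (cong₂ ℕ._+_ (trans (∑-cong (downFrom t) far⁺) (∑-reverse t _ _ odd))
                        (trans (∑-cong (downFrom t) far⁻) (∑-reverse t _ _ top))))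
           (cong₂ ℕ._+_ last⁻ last⁺) ⟩
    (∑ (downFrom s) p ℕ.+ ∑ (downFrom s) (λ k → q (suc (k ℕ.* 2)))
      ℕ.+ (∑ (downFrom t) (λ k → q (k ℕ.* 2)) ℕ.+ ∑ (downFrom t) (λ k → p (s ℕ.+ suc k))))
      ℕ.+ (q (suc (s ℕ.* 2)) ℕ.+ p s)
      ≡⟨ regroup (∑ (downFrom s) p) (∑ (downFrom s) (λ k → q (suc (k ℕ.* 2))))
                 (∑ (downFrom t) (λ k → q (k ℕ.* 2))) (∑ (downFrom t) (λ k → p (s ℕ.+ suc k))) (q (suc (s ℕ.* 2))) (p s) ⟩
    (∑ (downFrom t) (λ k → q (k ℕ.* 2)) ℕ.+ (q (suc (s ℕ.* 2)) ℕ.+ ∑ (downFrom s) (λ k → q (suc (k ℕ.* 2)))))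
      ℕ.+ (∑ (downFrom s) p ℕ.+ (p s ℕ.+ ∑ (downFrom t) (λ k → p (s ℕ.+ suc k))))
      ≡⟨ cong₂ ℕ._+_ (trans (cong (∑ (downFrom t) (λ k → q (k ℕ.* 2)) ℕ.+_) (sym (∑-∷ s (downFrom s) λ k → q (suc (k ℕ.* 2)))))
                            (sym (∑-mod2 t q)))
                     (sym (∑-thirds p)) ⟩
    ∑ (downFrom (t ℕ.* 2)) q ℕ.+ ∑ (downFrom (t ℕ.* 2)) p
      ≤⟨ ℕ.m≤n+m _ (D n e) ⟩
    D n e ℕ.+ (∑ (downFrom (t ℕ.* 2)) q ℕ.+ ∑ (downFrom (t ℕ.* 2)) p)
      ≡⟨ window e ⟩
    1 ∎
    where
    open ℕ.≤-Reasoning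
    e : ℤ
    e = η * (c + T)
    p q : ℕ → ℕ
    p k = D n (e + + suc k)
    q k = D n (e - + suc k)
    regroup : ∀ a b c d x y → a ℕ.+ b ℕ.+ (c ℕ.+ d) ℕ.+ (x ℕ.+ y) ≡ (c ℕ.+ (x ℕ.+ b)) ℕ.+ (a ℕ.+ (y ℕ.+ d))
    regroup = ℕ-Solver.solve-∀
    -- With i = `suc k`, the differences c + t + 2i and c + t - 4i halve to e + i and e - 2i.
    near⁺ : ∀ k → D n (c + (T - + suc k + + (suc k ℕ.* 3))) ≡ p k
    near⁺ k rewrite +suc*3 k = D-halve _ _ (+ suc k) (lemma T c (+ suc k))
      where
      lemma : ∀ T c k → (+ 1 + + 2 * T) * (c + (T - k + k * + 3)) ≡ (+ 1 + + 2 * T) * (c + T) + k + k * (+ 1 + T * + 4)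
      lemma = solve-∀
    near⁻ : ∀ k → D n (c + (T - + suc k - + (suc k ℕ.* 3))) ≡ q (suc (k ℕ.* 2))
    near⁻ k rewrite ℤ.pos-* (suc k) 3 | ℤ.pos-* (suc k) 2 = D-halve _ _ (- (+ 2 * + suc k))
      (trans (lemma T c (+ suc k)) (cong (λ x → η * (c + T) - x + - (+ 2 * + suc k) * (+ 1 + T * + 4)) (sym (ℤ.pos-* (suc k) 2))))
      where
      lemma : ∀ T c k → (+ 1 + + 2 * T) * (c + (T - k - k * + 3)) ≡ (+ 1 + + 2 * T) * (c + T) - k * + 2 + - (+ 2 * k) * (+ 1 + T * + 4)
      lemma = solve-∀
    -- With j = `suc k`, half of 4j - 1 is 2j - η. The numbers η - 2j are the odd ones up to 2t - 1,
    -- in decreasing order, whence the reversal in `odd`.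
    far⁺ : ∀ k → D n (c + (T + + suc k + + (2 ℕ.+ k ℕ.* 3))) ≡ D n (e - (η - + suc k * + 2))
    far⁺ k = trans (cong (λ x → D n (c + (T + + suc k + (+ 2 + x)))) (ℤ.pos-* k 3))
      (D-halve _ _ (+ 2 * + suc k) (lemma T c (+ k)))
      where
      lemma : ∀ T c k → (+ 1 + + 2 * T) * (c + (T + (+ 1 + k) + (+ 2 + k * + 3))) ≡
                        (+ 1 + + 2 * T) * (c + T) - ((+ 1 + + 2 * T) - (+ 1 + k) * + 2) + + 2 * (+ 1 + k) * (+ 1 + T * + 4)
      lemma = solve-∀
    -- Half of 1 - 2j is η - j, which descends from 2t to t + 1.
    far⁻ : ∀ k → D n (c + (T + + suc k - + (2 ℕ.+ k ℕ.* 3))) ≡ D n (e + (η - + suc k))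
    far⁻ k = trans (cong (λ x → D n (c + (T + + suc k - (+ 2 + x)))) (ℤ.pos-* k 3))
      (D-halve _ _ (- + suc k) (lemma T c (+ k)))
      where
      lemma : ∀ T c k → (+ 1 + + 2 * T) * (c + (T + (+ 1 + k) - (+ 2 + k * + 3))) ≡
                        (+ 1 + + 2 * T) * (c + T) + ((+ 1 + + 2 * T) - (+ 1 + k)) + - (+ 1 + k) * (+ 1 + T * + 4)
      lemma = solve-∀
    odd : ∀ i j → i ℕ.+ suc j ≡ t → D n (e - (η - + suc i * + 2)) ≡ q (j ℕ.* 2)
    odd i j eq = cong (λ x → D n (e - x)) (trans (cong (λ T → + 1 + + 2 * T - + suc i * + 2) (cong +_ (sym eq)))
      (trans (lemma (+ i) (+ j)) (cong (λ x → + 1 + x) (sym (ℤ.pos-* j 2)))))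
      where
      lemma : ∀ i j → + 1 + + 2 * (i + (+ 1 + j)) - (+ 1 + i) * + 2 ≡ + 1 + j * + 2
      lemma = solve-∀
    top : ∀ i j → i ℕ.+ suc j ≡ t → D n (e + (η - + suc i)) ≡ p (s ℕ.+ suc j)
    top i j eq = cong (λ x → D n (e + x)) (trans (lemma₀ T (+ suc i))
      (cong (λ x → T + x) (trans (cong (λ T → + 1 + T - + suc i) (cong +_ (sym eq))) (lemma (+ i) (+ j)))))
      where
      lemma₀ : ∀ T i → + 1 + + 2 * T - i ≡ T + (+ 1 + T - i)
      lemma₀ = solve-∀
      lemma : ∀ i j → + 1 + (i + (+ 1 + j)) - (+ 1 + i) ≡ + 1 + j
      lemma = solve-∀
    -- The two remaining offsets: c - 3t = c + t - 4t halves to e - 2t, and c + 3t = c + t + 2t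
    -- halves to e + t.
    last⁻ : D n (c - T * + 3) ≡ q (suc (s ℕ.* 2))
    last⁻ = trans (D-halve _ _ (- (+ 2 * T)) (lemma T c)) (cong (λ x → D n (e - x)) (sym (ℤ.pos-* t 2)))
      where
      lemma : ∀ T c → (+ 1 + + 2 * T) * (c - T * + 3) ≡ (+ 1 + + 2 * T) * (c + T) - T * + 2 + - (+ 2 * T) * (+ 1 + T * + 4)
      lemma = solve-∀
    last⁺ : D n (c + T * + 3) ≡ p s
    last⁺ = D-halve _ _ T (lemma T c)
      where
      lemma : ∀ T c → (+ 1 + + 2 * T) * (c + T * + 3) ≡ (+ 1 + + 2 * T) * (c + T) + T + T * (+ 1 + T * + 4)
      lemma = solve-∀

-- Points, their encoding, and designs realised from counting conditions

module Points (n r : ℕ) {{_ : NonZero n}} where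

  open import Data.Integer using (_+_; _-_; _*_; -_)

  -- pt a k stands for the point (a mod n , k mod 3), and ν i for the i-th point outside X.
  data Pt : Set where
    pt : ℤ → ℤ → Pt
    ∞  : Pt
    ν  : Fin r → Pt

  -- Equality of the points represented, as a number: coordinates are integers, so propositional
  -- equality on `Pt` would be too fine.
  Δ : Pt → Pt → ℕ
  Δ (pt a k) (pt b l) = D n (a - b) ℕ.* D 3 (k - l)
  Δ (pt _ _) ∞        = 0
  Δ (pt _ _) (ν _)    = 0
  Δ ∞        (pt _ _) = 0
  Δ ∞        ∞        = 1
  Δ ∞        (ν _)    = 0
  Δ (ν _)    (pt _ _) = 0
  Δ (ν _)    ∞        = 0
  Δ (ν i)    (ν j)    = 𝟙 (i ≟ j)

  v N : ℕ
  v = n ℕ.* 3 ℕ.+ 1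
  N = v ℕ.+ r

  inner : Fin (n ℕ.* 3) ⊎ Fin 1 → Fin N
  inner s = join (n ℕ.* 3) 1 s ↑ˡ r

  enc : Pt → Fin N
  enc (pt a k) = inner (inj₁ (combine (residue n a) (residue 3 k)))
  enc ∞        = inner (inj₂ zero)
  enc (ν i)    = v ↑ʳ i

  inner-injective : ∀ s s′ → inner s ≡ inner s′ → s ≡ s′
  inner-injective s s′ eq = trans (sym (Fin.splitAt-join (n ℕ.* 3) 1 s))
    (trans (cong (splitAt (n ℕ.* 3)) (Fin.↑ˡ-injective r _ _ eq)) (Fin.splitAt-join (n ℕ.* 3) 1 s′))

  inner≢ν : ∀ s i → inner s ≢ v ↑ʳ i
  inner≢ν s i eq = contradiction
    (trans (sym (Fin.splitAt-↑ˡ v (join (n ℕ.* 3) 1 s) r)) (trans (cong (splitAt v) eq) (Fin.splitAt-↑ʳ v r i)))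
    λ ()

  𝟙-enc : ∀ p q → 𝟙 (enc p ≟ enc q) ≡ Δ p q
  𝟙-enc (pt a k) (pt b l) = trans
    (𝟙-cong (enc (pt a k) ≟ enc (pt b l)) ((+ n ∣? a - b) ×-dec (+ 3 ∣? k - l))
      (λ eq → let eq₁ , eq₂ = Fin.combine-injective _ _ _ _ (inj₁-injective (inner-injective _ _ eq)) in
              residue-cong⁻¹ n a b eq₁ , residue-cong⁻¹ 3 k l eq₂)
      (λ { (d , e) → cong (inner ∘ inj₁) (cong₂ combine (residue-cong n a b d) (residue-cong 3 k l e)) }))
    (trans (𝟙-× (+ n ∣? a - b) (+ 3 ∣? k - l)) (cong₂ ℕ._*_ (sym (D-𝟙 n _)) (sym (D-𝟙 3 _))))
    where
    inj₁-injective : ∀ {A B : Set} {x y : A} → inj₁ {B = B} x ≡ inj₁ y → x ≡ y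
    inj₁-injective refl = refl
  𝟙-enc (pt a k) ∞        = 𝟙-false (enc (pt a k) ≟ enc ∞) λ eq →
    contradiction (inner-injective (inj₁ (combine (residue n a) (residue 3 k))) (inj₂ zero) eq) λ ()
  𝟙-enc (pt a k) (ν i)    = 𝟙-false (enc (pt a k) ≟ enc (ν i)) (inner≢ν (inj₁ (combine (residue n a) (residue 3 k))) i)
  𝟙-enc ∞        (pt b l) = 𝟙-false (enc ∞ ≟ enc (pt b l)) λ eq →
    contradiction (inner-injective (inj₂ zero) (inj₁ (combine (residue n b) (residue 3 l))) eq) λ ()
  𝟙-enc ∞        ∞        = 𝟙-true (enc ∞ ≟ enc ∞) refl
  𝟙-enc ∞        (ν i)    = 𝟙-false (enc ∞ ≟ enc (ν i)) (inner≢ν (inj₂ zero) i)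
  𝟙-enc (ν i)    (pt b l) = 𝟙-false (enc (ν i) ≟ enc (pt b l)) (inner≢ν (inj₁ (combine (residue n b) (residue 3 l))) i ∘ sym)
  𝟙-enc (ν i)    ∞        = 𝟙-false (enc (ν i) ≟ enc ∞) (inner≢ν (inj₂ zero) i ∘ sym)
  𝟙-enc (ν i)    (ν j)    = 𝟙-cong (enc (ν i) ≟ enc (ν j)) (i ≟ j) (Fin.↑ʳ-injective v i j) (cong enc-ν)
    where
    enc-ν : Fin r → Fin N
    enc-ν = v ↑ʳ_

  Δ≡0⇒≢ : ∀ p q → Δ p q ≡ 0 → enc p ≢ enc q
  Δ≡0⇒≢ p q Δ≡0 eq = ℕ.0≢1+n (trans (sym Δ≡0) (trans (sym (𝟙-enc p q)) (𝟙-true (enc p ≟ enc q) eq)))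

  ≢⇒Δ≡0 : ∀ p q → enc p ≢ enc q → Δ p q ≡ 0
  ≢⇒Δ≡0 p q p≢q = trans (sym (𝟙-enc p q)) (𝟙-false (enc p ≟ enc q) p≢q)

  data Old : Pt → Set where
    pt : ∀ a k → Old (pt a k)
    ∞  : Old ∞

  X : Subset N
  X = ⊤ {v} Vec.++ ⊥ {r}

  Old⇒∈X : ∀ {p} → Old p → enc p ∈ X
  Old⇒∈X (pt a k) = ∈-++⊥ (join (n ℕ.* 3) 1 (inj₁ (combine (residue n a) (residue 3 k))))
  Old⇒∈X ∞        = ∈-++⊥ (join (n ℕ.* 3) 1 (inj₂ zero))

  decode-inner : ∀ s → Σ[ p ∈ Pt ] Old p × enc p ≡ inner s
  decode-inner (inj₁ i) with Fin.combine-surjective {m = n} i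
  ... | a , k , refl = pt (+ toℕ a) (+ toℕ k) , pt _ _ ,
    cong (inner ∘ inj₁) (cong₂ combine (residue-surjective n a) (residue-surjective 3 k))
  decode-inner (inj₂ zero) = ∞ , ∞ , refl

  decode : ∀ x → Σ[ p ∈ Pt ] enc p ≡ x
  decode x with splitAt v x in eq
  ... | inj₂ i = ν i , Fin.splitAt⁻¹-↑ʳ {v} eq
  ... | inj₁ j with decode-inner (splitAt (n ℕ.* 3) j)
  ...   | p , _ , p≡ = p , trans p≡ (trans (cong (_↑ˡ r) (Fin.join-splitAt (n ℕ.* 3) 1 j)) (Fin.splitAt⁻¹-↑ˡ {v} eq))

  decode-X : ∀ {x} → x ∈ X → Σ[ p ∈ Pt ] Old p × enc p ≡ x
  decode-X {x} x∈X with decode x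
  ... | pt a k , eq   = pt a k , pt a k , eq
  ... | ∞      , eq   = ∞ , ∞ , eq
  ... | ν i    , refl = contradiction x∈X (∉-++⊥ v i)

  record Nested : Set where
    constructor _◂_
    field
      block : List Pt
      nest  : Pt

  open Nested public

  record Proper (l : Nested) : Set where
    field
      triple : length (block l) ≡ 3
      old    : All Old (block l)
      apart  : AllPairs (λ p q → Δ p q ≡ 0) (block l)
      avoid  : All (λ p → Δ (nest l) p ≡ 0) (block l)

  open Proper public

  mem : Pt → Nested → ℕ
  mem x l = ∑ (block l) (Δ x)

  covered : List Nested → Pt → Pt → ℕ
  covered L x y = ∑ L (λ l → mem x l ℕ.* mem y l)

  -- Deliberately asymmetric: `x` lies in the triple and `y` is its nesting point. An augmented pair
  -- count takes this in both orders.
  added : List Nested → Pt → Pt → ℕ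
  added L x y = ∑ L (λ l → mem x l ℕ.* Δ y (nest l))

  ⟦_⟧ : Nested → Subset N
  ⟦ l ⟧ = fromList (map enc (block l))

  module Realise (L : List Nested) (proper : All Proper L)
    (covered-2 : ∀ {x y} → Old x → Old y → Δ x y ≡ 0 → covered L x y ≡ 2)
    (covered-3 : ∀ x y → Δ x y ≡ 0 → covered L x y ℕ.+ (added L x y ℕ.+ added L y x) ≤ 3) where

    unique : ∀ {l} → Proper l → AllPairs _≢_ (map enc (block l))
    unique p = AllPairs.map⁺ (AllPairs.map (λ {x} {y} → Δ≡0⇒≢ x y) (apart p))

    nest∉ : ∀ {l} → Proper l → enc (nest l) ∉ ⟦ l ⟧
    nest∉ {l} p = ∉-fromList (All.map⁺ (All.map (λ {x} → Δ≡0⇒≢ (nest l) x) (avoid p)))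

    size : ∀ {l} → Proper l → ∣ ⟦ l ⟧ ∣ ≡ 3
    size {l} p = trans (∣fromList∣ (unique p)) (trans (List.length-map enc (block l)) (triple p))

    𝟙-block : ∀ {l} → Proper l → ∀ x → 𝟙 (enc x ∈? ⟦ l ⟧) ≡ mem x l
    𝟙-block {l} p x = trans (𝟙-fromList (enc x) (unique p))
      (trans (∑-map enc (block l) _) (∑-cong (block l) (𝟙-enc x)))

    𝟙-aug : ∀ {l} → Proper l → ∀ x → 𝟙 (enc x ∈? (⟦ l ⟧ ∪ ⁅ enc (nest l) ⁆)) ≡ mem x l ℕ.+ Δ x (nest l)
    𝟙-aug {l} p x = trans (𝟙-∪⁅⁆ ⟦ l ⟧ (enc x) (nest∉ p)) (cong₂ ℕ._+_ (𝟙-block p x) (𝟙-enc x (nest l)))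

    𝒜 : List (Subset N)
    𝒜 = map ⟦_⟧ L

    φ : Fin (length 𝒜) → Fin N
    φ = transport ⟦_⟧ (enc ∘ nest) L

    -- Two distinct points cannot both be the nesting point; this removes the last product when an
    -- augmented pair count is expanded.
    Δ-Δ : ∀ x y → Δ x y ≡ 0 → ∀ z → Δ x z ℕ.* Δ y z ≡ 0
    Δ-Δ x y Δ≡0 z with enc x ≟ enc z
    ... | no  x≢z = cong (ℕ._* Δ y z) (≢⇒Δ≡0 x z x≢z)
    ... | yes x≡z = trans (cong (Δ x z ℕ.*_) (≢⇒Δ≡0 y z λ y≡z → Δ≡0⇒≢ x y Δ≡0 (trans x≡z (sym y≡z)))) (ℕ.*-zeroʳ (Δ x z))

    pairs-𝒜 : ∀ x y → pairCount 𝒜 (enc x) (enc y) ≡ covered L x y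
    pairs-𝒜 x y = trans (pairCount-∑ ⟦_⟧ L (enc x) (enc y))
      (∑-cong-All (All.map (λ p → cong₂ ℕ._*_ (𝟙-block p x) (𝟙-block p y)) proper))

    pairs-aug : ∀ x y → Δ x y ≡ 0 →
                pairCount (augment 𝒜 φ) (enc x) (enc y) ≡ covered L x y ℕ.+ (added L x y ℕ.+ added L y x)
    pairs-aug x y Δ≡0 = begin
      pairCount (augment 𝒜 φ) (enc x) (enc y)
        ≡⟨ cong (λ B → pairCount B (enc x) (enc y)) (augment-map ⟦_⟧ (enc ∘ nest) L) ⟩
      pairCount (map (λ l → ⟦ l ⟧ ∪ ⁅ enc (nest l) ⁆) L) (enc x) (enc y)
        ≡⟨ pairCount-∑ (λ l → ⟦ l ⟧ ∪ ⁅ enc (nest l) ⁆) L (enc x) (enc y) ⟩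
      ∑ L (λ l → 𝟙 (enc x ∈? (⟦ l ⟧ ∪ ⁅ enc (nest l) ⁆)) ℕ.* 𝟙 (enc y ∈? (⟦ l ⟧ ∪ ⁅ enc (nest l) ⁆)))
        ≡⟨ ∑-cong-All (All.map (λ {l} p → trans (cong₂ ℕ._*_ (𝟙-aug p x) (𝟙-aug p y))
             (expand (mem x l) (mem y l) (Δ x (nest l)) (Δ y (nest l)) (Δ-Δ x y Δ≡0 (nest l)))) proper) ⟩
      ∑ L (λ l → mem x l ℕ.* mem y l ℕ.+ (mem x l ℕ.* Δ y (nest l) ℕ.+ mem y l ℕ.* Δ x (nest l)))
        ≡⟨ ∑-+ L _ _ ⟩
      covered L x y ℕ.+ ∑ L (λ l → mem x l ℕ.* Δ y (nest l) ℕ.+ mem y l ℕ.* Δ x (nest l))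
        ≡⟨ cong (covered L x y ℕ.+_) (∑-+ L _ _) ⟩
      covered L x y ℕ.+ (added L x y ℕ.+ added L y x) ∎
      where
      open ≡-Reasoning
      expand : ∀ a b u w → u ℕ.* w ≡ 0 → (a ℕ.+ u) ℕ.* (b ℕ.+ w) ≡ a ℕ.* b ℕ.+ (a ℕ.* w ℕ.+ b ℕ.* u)
      expand a b u w uw≡0 = trans (lemma a b u w) (trans (cong (a ℕ.* b ℕ.+ (a ℕ.* w ℕ.+ b ℕ.* u) ℕ.+_) uw≡0) (ℕ.+-identityʳ _))
        where
        lemma : ∀ a b u w → (a ℕ.+ u) ℕ.* (b ℕ.+ w) ≡ a ℕ.* b ℕ.+ (a ℕ.* w ℕ.+ b ℕ.* u) ℕ.+ u ℕ.* w
        lemma = ℕ-Solver.solve-∀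

    isBIBD : IsBIBD v 3 2 X 𝒜
    isBIBD = record
      { points = ∣⊤++⊥∣ v
      ; blocks = All.map⁺ (All.map (λ p → (λ {_} → ∈-fromList⁻ (All.map⁺ (All.map Old⇒∈X (old p)))) , size p) proper)
      ; pairs  = pairs
      }
      where
      pairs : ∀ {x y} → x ∈ X → y ∈ X → x ≢ y → pairCount 𝒜 x y ≡ 2
      pairs x∈X y∈X x≢y with decode-X x∈X | decode-X y∈X
      ... | p , old-p , refl | q , old-q , refl = trans (pairs-𝒜 p q) (covered-2 old-p old-q (≢⇒Δ≡0 p q x≢y))

    isPartialBIBD : IsPartialBIBD N 4 3 ⊤ (augment 𝒜 φ)
    isPartialBIBD = record
      { points = ∣⊤∣≡n N
      ; blocks = subst (All _) (sym (augment-map ⟦_⟧ (enc ∘ nest) L))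
          (All.map⁺ (All.map (λ p → (λ {_} → ⊆⊤) , trans (∣∪⁅⁆∣ _ (nest∉ p)) (cong suc (size p))) proper))
      ; pairs  = λ _ _ → pairs
      }
      where
      pairs : ∀ {x y} → x ≢ y → pairCount (augment 𝒜 φ) x y ≤ 3
      pairs {x} {y} x≢y with decode x | decode y
      ... | p , refl | q , refl =
        subst (_≤ 3) (sym (pairs-aug p q (≢⇒Δ≡0 p q x≢y))) (covered-3 p q (≢⇒Δ≡0 p q x≢y))

    isWeakNesting : IsWeakNesting v N 3 2 X ⊤ 𝒜 φ
    isWeakNesting = record
      { bibd    = isBIBD
      ; X⊆Y     = ⊆⊤
      ; ∣Y∣≡w   = ∣⊤∣≡n N
      ; into    = λ _ → ∈⊤
      ; avoids  = transport-All ⟦_⟧ (enc ∘ nest) _∉_ (All.map nest∉ proper)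
      ; partial = isPartialBIBD
      }

-- Orbits under ℤₙ × ℤ₃ and the method of differences

module Orbits (n r : ℕ) {{_ : NonZero n}} where

  open import Data.Integer using (_+_; _-_; _*_; -_)

  open Points n r

  shift : ℤ → ℤ → Pt → Pt
  shift g i (pt b l) = pt (b + g) (l + i)
  shift g i ∞        = ∞
  shift g i (ν j)    = ν j

  translate : ℤ → ℤ → Nested → Nested
  translate g i l = map (shift g i) (block l) ◂ shift g i (nest l)

  row : Nested → ℕ → List Nested
  row l g = map (λ i → translate (+ g) (+ i) l) (downFrom 3)

  orbit : Nested → List Nested
  orbit l = concatMap (row l) (downFrom n)

  ∑G : (ℤ → ℤ → ℕ) → ℕ
  ∑G f = ∑ (downFrom n) (λ g → ∑ (downFrom 3) (λ i → f (+ g) (+ i)))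

  ∑-orbit : ∀ l f → ∑ (orbit l) f ≡ ∑G (λ g i → f (translate g i l))
  ∑-orbit l f = trans (∑-concatMap (row l) (downFrom n) f)
    (∑-cong (downFrom n) λ g → ∑-map (λ i → translate (+ g) (+ i) l) (downFrom 3) f)

  ∑G-cong : ∀ {f h} → (∀ g i → f g i ≡ h g i) → ∑G f ≡ ∑G h
  ∑G-cong eq = ∑-cong (downFrom n) λ g → ∑-cong (downFrom 3) λ i → eq (+ g) (+ i)

  ∑G-zero : ∀ {f} → (∀ g i → f g i ≡ 0) → ∑G f ≡ 0
  ∑G-zero eq = ∑-zero (downFrom n) λ g → ∑-zero (downFrom 3) λ i → eq (+ g) (+ i)

  ∑G-swap : ∀ {A : Set} (xs : List A) (f : ℤ → ℤ → A → ℕ) →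
            ∑G (λ g i → ∑ xs (f g i)) ≡ ∑ xs (λ x → ∑G (λ g i → f g i x))
  ∑G-swap xs f = trans (∑-cong (downFrom n) λ g → ∑-swap (downFrom 3) xs (λ i → f (+ g) (+ i)))
    (∑-swap (downFrom n) xs (λ g x → ∑ (downFrom 3) (λ i → f (+ g) (+ i) x)))

  ∑G-* : ∀ (f h : ℤ → ℕ) → ∑G (λ g i → f g ℕ.* h i) ≡ ∑ (downFrom n) (f ∘ +_) ℕ.* ∑ (downFrom 3) (h ∘ +_)
  ∑G-* f h = sym (∑-* (downFrom n) (downFrom 3) (f ∘ +_) (h ∘ +_))

  -- The number of translations carrying `p` to `x` and `q` to `y`; orbit counts become sums of
  -- these over pairs of base points.
  hits : Pt → Pt → Pt → Pt → ℕ
  hits x p y q = ∑G (λ g i → Δ x (shift g i p) ℕ.* Δ y (shift g i q))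

  mem-translate : ∀ x g i l → mem x (translate g i l) ≡ ∑ (block l) (λ p → Δ x (shift g i p))
  mem-translate x g i l = ∑-map (shift g i) (block l) (Δ x)

  covered-orbit : ∀ l x y → covered (orbit l) x y ≡ ∑ (block l) (λ p → ∑ (block l) (λ q → hits x p y q))
  covered-orbit l x y = trans (∑-orbit l _) (trans
    (∑G-cong λ g i → trans (cong₂ ℕ._*_ (mem-translate x g i l) (mem-translate y g i l))
                           (∑-* (block l) (block l) _ _))
    (trans (∑G-swap (block l) λ g i p → ∑ (block l) (λ q → Δ x (shift g i p) ℕ.* Δ y (shift g i q)))
           (∑-cong (block l) λ p → ∑G-swap (block l) λ g i q → Δ x (shift g i p) ℕ.* Δ y (shift g i q))))

  added-orbit : ∀ l x y → added (orbit l) x y ≡ ∑ (block l) (λ p → hits x p y (nest l))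
  added-orbit l x y = trans (∑-orbit l _) (trans
    (∑G-cong λ g i → trans (cong (ℕ._* Δ y (shift g i (nest l))) (mem-translate x g i l))
                           (sym (∑-*ʳ (block l) _ _)))
    (∑G-swap (block l) λ g i p → Δ x (shift g i p) ℕ.* Δ y (shift g i (nest l))))

  ∑G-Δ : ∀ a k β ℓ → ∑G (λ g i → Δ (pt a k) (pt (β + g) (ℓ + i))) ≡ 1
  ∑G-Δ a k β ℓ = trans (∑G-* (λ g → D n (a - (β + g))) (λ i → D 3 (k - (ℓ + i))))
    (cong₂ ℕ._*_
      (trans (∑-cong (downFrom n) λ g → cong (D n) (reassoc a β (+ g))) (∑-residues n (a - β)))
      (trans (∑-cong (downFrom 3) λ i → cong (D 3) (reassoc k ℓ (+ i))) (∑-residues 3 (k - ℓ))))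
    where
    reassoc : ∀ a β g → a - (β + g) ≡ a - β - g
    reassoc = solve-∀

  -- A translation carries one pair to another exactly when their differences agree, and then it is
  -- unique. The free `c` and `κ` let each use supply its differences in simplified form.
  hits-pt : ∀ a k β ℓ b l β′ ℓ′ {c κ} → (b - a) - (β′ - β) ≡ c → (l - k) - (ℓ′ - ℓ) ≡ κ →
            hits (pt a k) (pt β ℓ) (pt b l) (pt β′ ℓ′) ≡ D n c ℕ.* D 3 κ
  hits-pt a k β ℓ b l β′ ℓ′ refl refl = begin
    ∑G (λ g i → D n (a - (β + g)) ℕ.* D 3 (k - (ℓ + i)) ℕ.* (D n (b - (β′ + g)) ℕ.* D 3 (l - (ℓ′ + i))))
      ≡⟨ ∑G-cong (λ g i → interchange (D n (a - (β + g))) (D 3 (k - (ℓ + i))) (D n (b - (β′ + g))) (D 3 (l - (ℓ′ + i)))) ⟩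
    ∑G (λ g i → D n (a - (β + g)) ℕ.* D n (b - (β′ + g)) ℕ.* (D 3 (k - (ℓ + i)) ℕ.* D 3 (l - (ℓ′ + i))))
      ≡⟨ ∑G-* (λ g → D n (a - (β + g)) ℕ.* D n (b - (β′ + g))) (λ i → D 3 (k - (ℓ + i)) ℕ.* D 3 (l - (ℓ′ + i))) ⟩
    ∑ (downFrom n) (λ g → D n (a - (β + + g)) ℕ.* D n (b - (β′ + + g)))
      ℕ.* ∑ (downFrom 3) (λ i → D 3 (k - (ℓ + + i)) ℕ.* D 3 (l - (ℓ′ + + i)))
      ≡⟨ cong₂ ℕ._*_ (factor n a β b β′) (factor 3 k ℓ l ℓ′) ⟩
    D n ((b - a) - (β′ - β)) ℕ.* D 3 ((l - k) - (ℓ′ - ℓ)) ∎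
    where
    open ≡-Reasoning
    interchange : ∀ x y z w → x ℕ.* y ℕ.* (z ℕ.* w) ≡ x ℕ.* z ℕ.* (y ℕ.* w)
    interchange = ℕ-Solver.solve-∀
    reassoc : ∀ a β g → a - (β + g) ≡ a - β - g
    reassoc = solve-∀
    rearrange : ∀ a β b β′ → b - β′ - (a - β) ≡ (b - a) - (β′ - β)
    rearrange = solve-∀
    factor : ∀ m {{_ : NonZero m}} a β b β′ →
             ∑ (downFrom m) (λ g → D m (a - (β + + g)) ℕ.* D m (b - (β′ + + g))) ≡ D m ((b - a) - (β′ - β))
    factor m a β b β′ = trans
      (∑-cong (downFrom m) λ g → cong₂ (λ u w → D m u ℕ.* D m w) (reassoc a β (+ g)) (reassoc b β′ (+ g)))
      (trans (∑-residues² m (a - β) (b - β′)) (cong (D m) (rearrange a β b β′)))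

  hits-zeroˡ : ∀ x p y q → (∀ g i → Δ x (shift g i p) ≡ 0) → hits x p y q ≡ 0
  hits-zeroˡ x p y q zer = ∑G-zero λ g i → cong (ℕ._* Δ y (shift g i q)) (zer g i)

  hits-zeroʳ : ∀ x p y q → (∀ g i → Δ y (shift g i q) ≡ 0) → hits x p y q ≡ 0
  hits-zeroʳ x p y q zer = ∑G-zero λ g i → trans (cong (Δ x (shift g i p) ℕ.*_) (zer g i)) (ℕ.*-zeroʳ (Δ x (shift g i p)))

  hits-∞-pt : ∀ b l β ℓ → hits ∞ ∞ (pt b l) (pt β ℓ) ≡ 1
  hits-∞-pt b l β ℓ = trans (∑G-cong λ g i → ℕ.+-identityʳ (Δ (pt b l) (pt (β + g) (ℓ + i)))) (∑G-Δ b l β ℓ)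

  -- New points are fixed by every translation, and exactly one translation carries one old finite
  -- point to another.
  hits-pt-ν : ∀ a k β ℓ i j → hits (pt a k) (pt β ℓ) (ν i) (ν j) ≡ 𝟙 (i ≟ j)
  hits-pt-ν a k β ℓ i j = begin
    ∑G (λ g h → Δ (pt a k) (pt (β + g) (ℓ + h)) ℕ.* 𝟙 (i ≟ j))
      ≡⟨ ∑-cong (downFrom n) (λ g → ∑-*ʳ (downFrom 3) _ (𝟙 (i ≟ j))) ⟩
    ∑ (downFrom n) (λ g → ∑ (downFrom 3) (λ h → Δ (pt a k) (pt (β + + g) (ℓ + + h))) ℕ.* 𝟙 (i ≟ j))
      ≡⟨ ∑-*ʳ (downFrom n) _ (𝟙 (i ≟ j)) ⟩
    ∑G (λ g h → Δ (pt a k) (pt (β + g) (ℓ + h))) ℕ.* 𝟙 (i ≟ j)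
      ≡⟨ cong (ℕ._* 𝟙 (i ≟ j)) (∑G-Δ a k β ℓ) ⟩
    1 ℕ.* 𝟙 (i ≟ j)
      ≡⟨ ℕ.*-identityˡ _ ⟩
    𝟙 (i ≟ j) ∎
    where open ≡-Reasoning

  bose : ℤ → ℤ → Pt → Nested
  bose S d z = (pt (S + d) (+ 0) ∷ pt (S - d) (+ 0) ∷ pt S (+ 1) ∷ []) ◂ z

  ∑³ : ∀ {A : Set} (x y z : A) (f : A → A → ℕ) →
       ∑ (x ∷ y ∷ z ∷ []) (λ p → ∑ (x ∷ y ∷ z ∷ []) (f p))
       ≡ (f x x ℕ.+ (f x y ℕ.+ f x z)) ℕ.+ ((f y x ℕ.+ (f y y ℕ.+ f y z)) ℕ.+ (f z x ℕ.+ (f z y ℕ.+ f z z)))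
  ∑³ x y z f = trans (∑-3 x y z _) (cong₂ ℕ._+_ (∑-3 x y z (f x)) (cong₂ ℕ._+_ (∑-3 x y z (f y)) (∑-3 x y z (f z))))

  -- Of the nine ordered pairs of base points, the three diagonal ones vanish by `apart`, the two
  -- within level 0 differ by ±2d, and the four between levels differ by ±d. The centre cancels.
  covered-bose : ∀ S d z a k b l → Δ (pt a k) (pt b l) ≡ 0 →
    let c = b - a ; κ = l - k in
    covered (orbit (bose S d z)) (pt a k) (pt b l)
    ≡ D 3 κ ℕ.* (D n (c - (d + d)) ℕ.+ D n (c + (d + d)))
      ℕ.+ (D 3 (κ - + 1) ℕ.+ D 3 (κ + + 1)) ℕ.* (D n (c - d) ℕ.+ D n (c + d))
  covered-bose S d z a k b l apart = begin
    covered (orbit (bose S d z)) (pt a k) (pt b l)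
      ≡⟨ covered-orbit (bose S d z) (pt a k) (pt b l) ⟩
    ∑ (block (bose S d z)) (λ p → ∑ (block (bose S d z)) (λ q → hits (pt a k) p (pt b l) q))
      ≡⟨ ∑³ _ _ _ (λ p q → hits (pt a k) p (pt b l) q) ⟩
    (h (S + d) (+ 0) (S + d) (+ 0) ℕ.+ (h (S + d) (+ 0) (S - d) (+ 0) ℕ.+ h (S + d) (+ 0) S (+ 1)))
      ℕ.+ ((h (S - d) (+ 0) (S + d) (+ 0) ℕ.+ (h (S - d) (+ 0) (S - d) (+ 0) ℕ.+ h (S - d) (+ 0) S (+ 1)))
      ℕ.+ (h S (+ 1) (S + d) (+ 0) ℕ.+ (h S (+ 1) (S - d) (+ 0) ℕ.+ h S (+ 1) S (+ 1))))
      ≡⟨ cong₂ ℕ._+_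
           (cong₂ ℕ._+_ (hit (S + d) (+ 0) (S + d) (+ 0) (same c (S + d)) κ+0)
             (cong₂ ℕ._+_ (hit (S + d) (+ 0) (S - d) (+ 0) (PQ c S d) κ+0) (hit (S + d) (+ 0) S (+ 1) (PS c S d) refl)))
           (cong₂ ℕ._+_
             (cong₂ ℕ._+_ (hit (S - d) (+ 0) (S + d) (+ 0) (QP c S d) κ+0)
               (cong₂ ℕ._+_ (hit (S - d) (+ 0) (S - d) (+ 0) (same c (S - d)) κ+0) (hit (S - d) (+ 0) S (+ 1) (QS c S d) refl)))
             (cong₂ ℕ._+_ (hit S (+ 1) (S + d) (+ 0) (SP c S d) refl)
               (cong₂ ℕ._+_ (hit S (+ 1) (S - d) (+ 0) (SQ c S d) refl) (hit S (+ 1) S (+ 1) (same c S) κ+0)))) ⟩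
    (D n c ℕ.* e ℕ.+ (D n (c + (d + d)) ℕ.* e ℕ.+ D n (c + d) ℕ.* p))
      ℕ.+ ((D n (c - (d + d)) ℕ.* e ℕ.+ (D n c ℕ.* e ℕ.+ D n (c - d) ℕ.* p))
      ℕ.+ (D n (c - d) ℕ.* q ℕ.+ (D n (c + d) ℕ.* q ℕ.+ D n c ℕ.* e)))
      ≡⟨ collect (D n c ℕ.* e) (D n (c - (d + d))) (D n (c + (d + d))) (D n (c - d)) (D n (c + d)) e p q ⟩
    D n c ℕ.* e ℕ.* 3 ℕ.+ (e ℕ.* (D n (c - (d + d)) ℕ.+ D n (c + (d + d))) ℕ.+ (p ℕ.+ q) ℕ.* (D n (c - d) ℕ.+ D n (c + d)))
      ≡⟨ cong (λ x → x ℕ.* 3 ℕ.+ (e ℕ.* (D n (c - (d + d)) ℕ.+ D n (c + (d + d))) ℕ.+ (p ℕ.+ q) ℕ.* (D n (c - d) ℕ.+ D n (c + d))))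
           (trans (cong₂ ℕ._*_ (D-flip b a) (D-flip l k)) apart) ⟩
    e ℕ.* (D n (c - (d + d)) ℕ.+ D n (c + (d + d))) ℕ.+ (p ℕ.+ q) ℕ.* (D n (c - d) ℕ.+ D n (c + d)) ∎
    where
    open ≡-Reasoning
    c κ : ℤ
    c = b - a
    κ = l - k
    e p q : ℕ
    e = D 3 κ
    p = D 3 (κ - + 1)
    q = D 3 (κ + + 1)
    h : ℤ → ℤ → ℤ → ℤ → ℕ
    h β ℓ β′ ℓ′ = hits (pt a k) (pt β ℓ) (pt b l) (pt β′ ℓ′)
    hit : ∀ β ℓ β′ ℓ′ {c′ κ′} → c - (β′ - β) ≡ c′ → κ - (ℓ′ - ℓ) ≡ κ′ → h β ℓ β′ ℓ′ ≡ D n c′ ℕ.* D 3 κ′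
    hit β ℓ β′ ℓ′ = hits-pt a k β ℓ b l β′ ℓ′
    κ+0 : κ + + 0 ≡ κ
    κ+0 = ℤ.+-identityʳ κ
    same : ∀ c S → c - (S - S) ≡ c
    same = solve-∀
    PQ : ∀ c S d → c - ((S - d) - (S + d)) ≡ c + (d + d)
    PQ = solve-∀
    QP : ∀ c S d → c - ((S + d) - (S - d)) ≡ c - (d + d)
    QP = solve-∀
    PS : ∀ c S d → c - (S - (S + d)) ≡ c + d
    PS = solve-∀
    QS : ∀ c S d → c - (S - (S - d)) ≡ c - d
    QS = solve-∀
    SP : ∀ c S d → c - ((S + d) - S) ≡ c - d
    SP = solve-∀
    SQ : ∀ c S d → c - ((S - d) - S) ≡ c + d
    SQ = solve-∀
    collect : ∀ x w⁻ w⁺ u⁻ u⁺ e p q →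
      (x ℕ.+ (w⁺ ℕ.* e ℕ.+ u⁺ ℕ.* p)) ℕ.+ ((w⁻ ℕ.* e ℕ.+ (x ℕ.+ u⁻ ℕ.* p)) ℕ.+ (u⁻ ℕ.* q ℕ.+ (u⁺ ℕ.* q ℕ.+ x)))
      ≡ x ℕ.* 3 ℕ.+ (e ℕ.* (w⁻ ℕ.+ w⁺) ℕ.+ (p ℕ.+ q) ℕ.* (u⁻ ℕ.+ u⁺))
    collect = ℕ-Solver.solve-∀

-- Translation invariance and vanishing counts

module OrbitProperties (n r : ℕ) {{_ : NonZero n}} where

  open import Data.Integer using (_+_; _-_; _*_; -_)

  open Points n r
  open Orbits n r

  Δ-shift : ∀ g i p q → Δ (shift g i p) (shift g i q) ≡ Δ p q
  Δ-shift g i (pt a k) (pt b l) = cong₂ (λ u w → D n u ℕ.* D 3 w) (cancel a b g) (cancel k l i)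
    where
    cancel : ∀ a b g → a + g - (b + g) ≡ a - b
    cancel = solve-∀
  Δ-shift g i (pt a k) ∞        = refl
  Δ-shift g i (pt a k) (ν _)    = refl
  Δ-shift g i ∞        (pt b l) = refl
  Δ-shift g i ∞        ∞        = refl
  Δ-shift g i ∞        (ν _)    = refl
  Δ-shift g i (ν _)    (pt b l) = refl
  Δ-shift g i (ν _)    ∞        = refl
  Δ-shift g i (ν _)    (ν _)    = refl

  Old-shift : ∀ g i {p} → Old p → Old (shift g i p)
  Old-shift g i (pt a k) = pt (a + g) (k + i)
  Old-shift g i ∞        = ∞

  Proper-translate : ∀ g i {l} → Proper l → Proper (translate g i l)
  Proper-translate g i {l} p = record
    { triple = trans (List.length-map (shift g i) (block l)) (triple p)
    ; old    = All.map⁺ (All.map (Old-shift g i) (old p))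
    ; apart  = AllPairs.map⁺ (AllPairs.map (λ {x} {y} → trans (Δ-shift g i x y)) (apart p))
    ; avoid  = All.map⁺ (All.map (λ {x} → trans (Δ-shift g i (nest l) x)) (avoid p))
    }

  Proper-orbit : ∀ {l} → Proper l → All Proper (orbit l)
  Proper-orbit {l} p = All.concat⁺ (All.map⁺ {f = row l} (All.universal
    (λ g → All.map⁺ (All.universal (λ i → Proper-translate (+ g) (+ i) p) (downFrom 3))) (downFrom n)))

  Missed : Pt → Pt → Set
  Missed x p = ∀ g i → Δ x (shift g i p) ≡ 0

  ∑-missed : ∀ {A : Set} {xs : List A} {f} → All (λ x → f x ≡ 0) xs → ∑ xs f ≡ 0
  ∑-missed {xs = xs} eqs = trans (∑-cong-All eqs) (∑-zero xs λ _ → refl)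

  covered-missed : ∀ l x y → All (Missed x) (block l) → covered (orbit l) x y ≡ 0
  covered-missed l x y missed = trans (covered-orbit l x y)
    (∑-missed (All.map (λ {p} miss → ∑-zero (block l) λ q → hits-zeroˡ x p y q miss) missed))

  added-missed : ∀ l x y → All (Missed x) (block l) → added (orbit l) x y ≡ 0
  added-missed l x y missed = trans (added-orbit l x y)
    (∑-missed (All.map (λ {p} miss → hits-zeroˡ x p y (nest l) miss) missed))

  added-missed-nest : ∀ l x y → Missed y (nest l) → added (orbit l) x y ≡ 0
  added-missed-nest l x y miss = trans (added-orbit l x y)
    (∑-zero (block l) λ p → hits-zeroʳ x p y (nest l) miss)

  covered-sym : ∀ L x y → covered L x y ≡ covered L y x
  covered-sym L x y = ∑-cong L λ l → ℕ.*-comm (mem x l) (mem y l)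

  mem-ν : ∀ i {l} → Proper l → mem (ν i) l ≡ 0
  mem-ν i p = ∑-missed (All.map Δ-ν (old p))
    where
    Δ-ν : ∀ {q} → Old q → Δ (ν i) q ≡ 0
    Δ-ν (pt a k) = refl
    Δ-ν ∞        = refl

  covered-ν : ∀ {L} → All Proper L → ∀ i y → covered L (ν i) y ≡ 0
  covered-ν proper i y = ∑-missed (All.map (λ {l} p → cong (ℕ._* mem y l) (mem-ν i p)) proper)

  added-ν : ∀ {L} → All Proper L → ∀ i y → added L (ν i) y ≡ 0
  added-ν proper i y = ∑-missed (All.map (λ {l} p → cong (ℕ._* Δ y (nest l)) (mem-ν i p)) proper)

-- The nested design and its pair counts

module Design (s : ℕ) where

  open import Data.Integer using (_+_; _-_; _*_; -_)

  open Base
  open Family s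
  open Points n (suc (length external))
  open Orbits n (suc (length external))
  open OrbitProperties n (suc (length external))

  internalBlock : Base → Nested
  internalBlock b = bose (centre b) (radius b) (pt (+ 0) (+ 1))

  -- Any centre gives the same orbit of triples, and the nesting point is fixed by translations, so
  -- 0 is chosen. The `suc` reserves `ν zero` for the fibres.
  externalBlock : Fin (length external) → Nested
  externalBlock i = bose (+ 0) (lookup external i) (ν (suc i))

  cone : Nested
  cone = (∞ ∷ pt (+ 0) (+ 0) ∷ pt (+ 0) (+ 1) ∷ []) ◂ pt (T * + 3) (+ 2)

  -- Translation in ℤ₃ only permutes the points of a fibre, so `L` lists one block for each element
  -- of ℤₙ rather than a full `orbit`.
  fibre : ℕ → Nested
  fibre g = map (λ i → pt (+ g) (+ i)) (downFrom 3) ◂ ν zero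

  L : List Nested
  L = map fibre (downFrom n) ++ (orbit cone ++
      (concatMap (orbit ∘ internalBlock) internal ++ concatMap (orbit ∘ externalBlock) (allFin (length external))))

  ∑-L : ∀ f → ∑ L f ≡ ∑ (downFrom n) (f ∘ fibre) ℕ.+ (∑ (orbit cone) f ℕ.+
        (∑ internal (λ b → ∑ (orbit (internalBlock b)) f) ℕ.+ ∑ (allFin (length external)) (λ i → ∑ (orbit (externalBlock i)) f)))
  ∑-L f = trans (∑-++ (map fibre (downFrom n)) _ f) (cong₂ ℕ._+_ (∑-map fibre (downFrom n) f)
    (trans (∑-++ (orbit cone) _ f) (cong (∑ (orbit cone) f ℕ.+_)
      (trans (∑-++ (concatMap (orbit ∘ internalBlock) internal) _ f)
        (cong₂ ℕ._+_ (∑-concatMap (orbit ∘ internalBlock) internal f)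
                     (∑-concatMap (orbit ∘ externalBlock) (allFin (length external)) f))))))

  D-double : ∀ d → D n (d + d) ≡ D n d
  D-double d = D-halve (d + d) d d (lemma T d)
    where
    lemma : ∀ T d → (+ 1 + + 2 * T) * (d + d) ≡ d + d * (+ 1 + T * + 4)
    lemma = solve-∀

  level-apart : ∀ a b {κ} → D 3 κ ≡ 0 → D n (a - b) ℕ.* D 3 κ ≡ 0
  level-apart a b eq = trans (cong (D n (a - b) ℕ.*_) eq) (ℕ.*-zeroʳ (D n (a - b)))

  Proper-bose : ∀ S d z → D n d ≡ 0 → All (λ p → Δ z p ≡ 0) (block (bose S d z)) → Proper (bose S d z)
  Proper-bose S d z d≢0 avoids = record
    { triple = refl
    ; old    = pt _ _ ∷ pt _ _ ∷ pt _ _ ∷ []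
    ; apart  = (cong (ℕ._* D 3 (+ 0)) (trans (cong (D n) (lemma S d)) (trans (D-double d) d≢0)) ∷ level (S + d) S ∷ [])
             ∷ (level (S - d) S ∷ []) ∷ [] ∷ []
    ; avoid  = avoids
    }
    where
    lemma : ∀ S d → S + d - (S - d) ≡ d + d
    lemma = solve-∀
    level : ∀ a b → Δ (pt a (+ 0)) (pt b (+ 1)) ≡ 0
    -- At a numeral the divisibility test computes, so the right-hand side of `D-𝟙` is already 0.
    level a b = level-apart a b (D-𝟙 3 (- + 1))

  proper : All Proper L
  proper = All.++⁺ (All.map⁺ (All.universal fibre-proper (downFrom n))) (All.++⁺ (Proper-orbit cone-proper)
    (All.++⁺ (All.concat⁺ (All.map⁺ {f = orbit ∘ internalBlock}
               (All.map (λ {b} (r≢0 , c≢0) → Proper-orbit (internal-proper′ b r≢0 c≢0)) internal-proper)))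
             (All.concat⁺ (All.map⁺ {f = orbit ∘ externalBlock}
               (All.universal (λ i → Proper-orbit (external-proper′ i)) (allFin (length external)))))))
    where
    fibre-proper : ∀ g → Proper (fibre g)
    fibre-proper g = record
      { triple = refl
      ; old    = pt _ _ ∷ pt _ _ ∷ pt _ _ ∷ []
      ; apart  = (level-apart (+ g) (+ g) (D-𝟙 3 (+ 1)) ∷ level-apart (+ g) (+ g) (D-𝟙 3 (+ 2)) ∷ [])
               ∷ (level-apart (+ g) (+ g) (D-𝟙 3 (+ 1)) ∷ []) ∷ [] ∷ []
      ; avoid  = refl ∷ refl ∷ refl ∷ []
      }
    cone-proper : Proper cone
    cone-proper = record
      { triple = refl
      ; old    = ∞ ∷ pt _ _ ∷ pt _ _ ∷ []
      ; apart  = (refl ∷ refl ∷ []) ∷ (level-apart (+ 0) (+ 0) (D-𝟙 3 (- + 1)) ∷ []) ∷ [] ∷ []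
      ; avoid  = refl ∷ level-apart (T * + 3) (+ 0) (D-𝟙 3 (+ 2)) ∷ level-apart (T * + 3) (+ 0) (D-𝟙 3 (+ 1)) ∷ []
      }
    internal-proper′ : ∀ b → D n (radius b) ≡ 0 → D n (centre b) ≡ 0 → Proper (internalBlock b)
    internal-proper′ b r≢0 c≢0 = Proper-bose (centre b) (radius b) _ r≢0
      (level-apart (+ 0) (centre b + radius b) (D-𝟙 3 (+ 1)) ∷ level-apart (+ 0) (centre b - radius b) (D-𝟙 3 (+ 1)) ∷
       cong (ℕ._* D 3 (+ 0)) (trans (D-flip (+ 0) (centre b)) (trans (cong (D n) (ℤ.+-identityʳ (centre b))) c≢0)) ∷ [])
    external-proper′ : ∀ i → Proper (externalBlock i)
    external-proper′ i = Proper-bose (+ 0) (lookup external i) _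
      (All.lookup external-proper (∈-lookup i)) (refl ∷ refl ∷ refl ∷ [])

  mem-fibre : ∀ a k g → mem (pt a k) (fibre g) ≡ D n (a - + g)
  mem-fibre a k g = trans (∑-map (λ i → pt (+ g) (+ i)) (downFrom 3) (Δ (pt a k)))
    (trans (∑-*ˡ (D n (a - + g)) (downFrom 3) _)
      (trans (cong (D n (a - + g) ℕ.*_) (∑-residues 3 k)) (ℕ.*-identityʳ _)))

  mem-fibre-∞ : ∀ g → mem ∞ (fibre g) ≡ 0
  mem-fibre-∞ g = trans (∑-map (λ i → pt (+ g) (+ i)) (downFrom 3) (Δ ∞)) (∑-zero (downFrom 3) λ _ → refl)

  missed-bose : ∀ S d z → All (Missed ∞) (block (bose S d z))
  missed-bose S d z = (λ _ _ → refl) ∷ (λ _ _ → refl) ∷ (λ _ _ → refl) ∷ []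

  -- Halving turns a pure difference ±2d at `c` into ±d at c/2, so that `two-fold` answers for pure
  -- and mixed pairs alike.
  W-double : ∀ d c → D n (c - (d + d)) ℕ.+ D n (c + (d + d)) ≡ W d (η * c)
  W-double d c = cong₂ ℕ._+_ (D-halve (c - (d + d)) (η * c - d) (- d) (lemma₁ T c d))
                             (D-halve (c + (d + d)) (η * c + d) d (lemma₂ T c d))
    where
    lemma₁ : ∀ T c d → (+ 1 + + 2 * T) * (c - (d + d)) ≡ (+ 1 + + 2 * T) * c - d + - d * (+ 1 + T * + 4)
    lemma₁ = solve-∀
    lemma₂ : ∀ T c d → (+ 1 + + 2 * T) * (c + (d + d)) ≡ (+ 1 + + 2 * T) * c + d + d * (+ 1 + T * + 4)
    lemma₂ = solve-∀

  covered-fibres : ∀ a k b l → ∑ (downFrom n) (λ g → mem (pt a k) (fibre g) ℕ.* mem (pt b l) (fibre g)) ≡ D n (b - a)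
  covered-fibres a k b l = trans
    (∑-cong (downFrom n) λ g → cong₂ ℕ._*_ (mem-fibre a k g) (mem-fibre b l g)) (∑-residues² n a b)

  covered-cone : ∀ a k b l → Δ (pt a k) (pt b l) ≡ 0 → covered (orbit cone) (pt a k) (pt b l) ≡ D n (b - a)
  covered-cone a k b l apart = begin
    covered (orbit cone) x y
      ≡⟨ covered-orbit cone x y ⟩
    ∑ (block cone) (λ p → ∑ (block cone) (λ q → hits x p y q))
      ≡⟨ ∑³ ∞ o o′ (λ p q → hits x p y q) ⟩
    (hits x ∞ y ∞ ℕ.+ (hits x ∞ y o ℕ.+ hits x ∞ y o′))
      ℕ.+ ((hits x o y ∞ ℕ.+ (hits x o y o ℕ.+ hits x o y o′)) ℕ.+ (hits x o′ y ∞ ℕ.+ (hits x o′ y o ℕ.+ hits x o′ y o′)))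
      ≡⟨ cong₂ ℕ._+_
           (cong₂ ℕ._+_ (missˡ ∞) (cong₂ ℕ._+_ (missˡ o) (missˡ o′)))
           (cong₂ ℕ._+_
             (cong₂ ℕ._+_ (missʳ o) (cong₂ ℕ._+_ (hit (+ 0) (+ 0) κ+0) (hit (+ 0) (+ 1) refl)))
             (cong₂ ℕ._+_ (missʳ o′) (cong₂ ℕ._+_ (hit (+ 1) (+ 0) refl) (hit (+ 1) (+ 1) κ+0)))) ⟩
    (δ ℕ.* D 3 κ ℕ.+ δ ℕ.* D 3 (κ - + 1)) ℕ.+ (δ ℕ.* D 3 (κ + + 1) ℕ.+ δ ℕ.* D 3 κ)
      -- Both terms with `D 3 κ` vanish by `apart`; one is kept to complete the three level
      -- differences to `∑-D3`.
      ≡⟨ collect δ (D 3 κ) (D 3 (κ - + 1)) (D 3 (κ + + 1)) ⟩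
    δ ℕ.* D 3 κ ℕ.+ δ ℕ.* (D 3 κ ℕ.+ (D 3 (κ - + 1) ℕ.+ D 3 (κ + + 1)))
      ≡⟨ cong₂ (λ u w → u ℕ.+ δ ℕ.* w) (trans (cong₂ ℕ._*_ (D-flip b a) (D-flip l k)) apart) (∑-D3 κ) ⟩
    δ ℕ.* 1
      ≡⟨ ℕ.*-identityʳ δ ⟩
    δ ∎
    where
    open ≡-Reasoning
    x y o o′ : Pt
    x = pt a k
    y = pt b l
    o = pt (+ 0) (+ 0)
    o′ = pt (+ 0) (+ 1)
    κ : ℤ
    κ = l - k
    δ : ℕ
    δ = D n (b - a)
    κ+0 : κ + + 0 ≡ κ
    κ+0 = ℤ.+-identityʳ κ
    missˡ : ∀ q → hits x ∞ y q ≡ 0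
    missˡ q = hits-zeroˡ x ∞ y q λ _ _ → refl
    missʳ : ∀ p → hits x p y ∞ ≡ 0
    missʳ p = hits-zeroʳ x p y ∞ λ _ _ → refl
    hit : ∀ ℓ ℓ′ {κ′} → κ - (ℓ′ - ℓ) ≡ κ′ → hits x (pt (+ 0) ℓ) y (pt (+ 0) ℓ′) ≡ D n (b - a) ℕ.* D 3 κ′
    hit ℓ ℓ′ = hits-pt a k (+ 0) ℓ b l (+ 0) ℓ′ (ℤ.+-identityʳ (b - a))
    collect : ∀ δ e p q → (δ ℕ.* e ℕ.+ δ ℕ.* p) ℕ.+ (δ ℕ.* q ℕ.+ δ ℕ.* e) ≡ δ ℕ.* e ℕ.+ δ ℕ.* (e ℕ.+ (p ℕ.+ q))
    collect = ℕ-Solver.solve-∀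

  -- Fibres and cone together supply the summand `D n c * 2` of `two-fold`. The Bose orbits supply
  -- the rest, read at `η * c` with weight `e` (equal levels) and at `c` with weight `pq` (different
  -- levels); the weights sum to one.
  covered-pt-pt : ∀ a k b l → Δ (pt a k) (pt b l) ≡ 0 → covered L (pt a k) (pt b l) ≡ 2
  covered-pt-pt a k b l apart = begin
    covered L x y
      ≡⟨ ∑-L _ ⟩
    ∑ (downFrom n) (λ g → mem x (fibre g) ℕ.* mem y (fibre g)) ℕ.+ (covered (orbit cone) x y ℕ.+
      (∑ internal (λ b → covered (orbit (internalBlock b)) x y) ℕ.+
       ∑ (allFin (length external)) (λ i → covered (orbit (externalBlock i)) x y)))
      ≡⟨ cong₂ ℕ._+_ (covered-fibres a k b l) (cong₂ ℕ._+_ (covered-cone a k b l apart)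
           (cong₂ ℕ._+_
             (∑-cong internal λ b → trans (covered-bose (centre b) (radius b) (pt (+ 0) (+ 1)) a k _ l apart) (per-base (radius b)))
             (∑-cong (allFin (length external)) λ i →
               trans (covered-bose (+ 0) (lookup external i) (ν (suc i)) a k b l apart) (per-base (lookup external i))))) ⟩
    δ ℕ.+ (δ ℕ.+ (∑ internal (f ∘ radius) ℕ.+ ∑ (allFin (length external)) (f ∘ lookup external)))
      ≡⟨ cong (λ z → δ ℕ.+ (δ ℕ.+ (∑ internal (f ∘ radius) ℕ.+ z))) (∑-lookup external f) ⟩
    δ ℕ.+ (δ ℕ.+ (∑ internal (f ∘ radius) ℕ.+ ∑ external f))
      ≡⟨ cong (λ z → δ ℕ.+ (δ ℕ.+ z)) (cong₂ ℕ._+_ (linear internal radius) (linear external id)) ⟩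
    δ ℕ.+ (δ ℕ.+ ((e ℕ.* multiplicity (η * c) ℕ.+ pq ℕ.* multiplicity c)
             ℕ.+ (e ℕ.* ∑ external (λ d → W d (η * c)) ℕ.+ pq ℕ.* ∑ external (λ d → W d c))))
      ≡⟨ finish δ e pq _ _ _ _ (∑-D3 κ)
           (trans (cong (λ z → z ℕ.* 2 ℕ.+ (multiplicity (η * c) ℕ.+ ∑ external (λ d → W d (η * c)))) (sym (D-half c)))
                  (two-fold (η * c)))
           (two-fold c) ⟩
    2 ∎
    where
    open ≡-Reasoning
    x y : Pt
    x = pt a k
    y = pt b l
    c κ : ℤ
    c = b - a
    κ = l - k
    δ e pq : ℕ
    δ = D n c
    e = D 3 κ
    pq = D 3 (κ - + 1) ℕ.+ D 3 (κ + + 1)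
    f : ℤ → ℕ
    f d = e ℕ.* W d (η * c) ℕ.+ pq ℕ.* W d c
    per-base : ∀ d → e ℕ.* (D n (c - (d + d)) ℕ.+ D n (c + (d + d))) ℕ.+ pq ℕ.* (D n (c - d) ℕ.+ D n (c + d)) ≡ f d
    per-base d = cong (λ z → e ℕ.* z ℕ.+ pq ℕ.* W d c) (W-double d c)
    linear : ∀ {A : Set} (xs : List A) (r : A → ℤ) →
             ∑ xs (f ∘ r) ≡ e ℕ.* ∑ xs (λ b → W (r b) (η * c)) ℕ.+ pq ℕ.* ∑ xs (λ b → W (r b) c)
    linear xs r = trans (∑-+ xs _ _) (cong₂ ℕ._+_ (∑-*ˡ e xs _) (∑-*ˡ pq xs _))
    finish : ∀ δ e r A B A′ B′ → e ℕ.+ r ≡ 1 → δ ℕ.* 2 ℕ.+ (A ℕ.+ A′) ≡ 2 → δ ℕ.* 2 ℕ.+ (B ℕ.+ B′) ≡ 2 →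
             δ ℕ.+ (δ ℕ.+ ((e ℕ.* A ℕ.+ r ℕ.* B) ℕ.+ (e ℕ.* A′ ℕ.+ r ℕ.* B′))) ≡ 2
    finish δ e r A B A′ B′ e+r eqA eqB = trans (regroup δ e r A B A′ B′)
      (trans (cong (λ z → δ ℕ.* 2 ℕ.+ (e ℕ.* z ℕ.+ r ℕ.* (B ℕ.+ B′))) (ℕ.+-cancelˡ-≡ (δ ℕ.* 2) _ _ (trans eqA (sym eqB))))
      (trans (cong (δ ℕ.* 2 ℕ.+_) (trans (sym (ℕ.*-distribʳ-+ (B ℕ.+ B′) e r)) (trans (cong (ℕ._* (B ℕ.+ B′)) e+r) (ℕ.*-identityˡ _)))) eqB))
      where
      regroup : ∀ δ e r A B A′ B′ → δ ℕ.+ (δ ℕ.+ ((e ℕ.* A ℕ.+ r ℕ.* B) ℕ.+ (e ℕ.* A′ ℕ.+ r ℕ.* B′)))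
                ≡ δ ℕ.* 2 ℕ.+ (e ℕ.* (A ℕ.+ A′) ℕ.+ r ℕ.* (B ℕ.+ B′))
      regroup = ℕ-Solver.solve-∀

  covered-∞-pt : ∀ b l → covered L ∞ (pt b l) ≡ 2
  covered-∞-pt b l = begin
    covered L ∞ y
      ≡⟨ ∑-L _ ⟩
    ∑ (downFrom n) (λ g → mem ∞ (fibre g) ℕ.* mem y (fibre g)) ℕ.+ (covered (orbit cone) ∞ y ℕ.+
      (∑ internal (λ b → covered (orbit (internalBlock b)) ∞ y) ℕ.+
       ∑ (allFin (length external)) (λ i → covered (orbit (externalBlock i)) ∞ y)))
      ≡⟨ cong₂ ℕ._+_ (∑-zero (downFrom n) λ g → cong (ℕ._* mem y (fibre g)) (mem-fibre-∞ g)) (cong₂ ℕ._+_ cone-2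
           (cong₂ ℕ._+_ (∑-zero internal λ b → covered-missed (internalBlock b) ∞ y (missed-bose (centre b) (radius b) (pt (+ 0) (+ 1))))
                        (∑-zero (allFin (length external)) λ i →
                          covered-missed (externalBlock i) ∞ y (missed-bose (+ 0) (lookup external i) (ν (suc i)))))) ⟩
    2 ∎
    where
    open ≡-Reasoning
    y = pt b l
    cone-2 : covered (orbit cone) ∞ y ≡ 2
    cone-2 = trans (covered-orbit cone ∞ y) (trans (∑³ ∞ (pt (+ 0) (+ 0)) (pt (+ 0) (+ 1)) (λ p q → hits ∞ p y q)) (cong₂ ℕ._+_
      (cong₂ ℕ._+_ (hits-zeroʳ ∞ ∞ y ∞ λ _ _ → refl) (cong₂ ℕ._+_ (hits-∞-pt b l (+ 0) (+ 0)) (hits-∞-pt b l (+ 0) (+ 1))))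
      (cong₂ ℕ._+_ (miss (+ 0)) (miss (+ 1)))))
      where
      miss : ∀ ℓ → hits ∞ (pt (+ 0) ℓ) y ∞ ℕ.+ (hits ∞ (pt (+ 0) ℓ) y (pt (+ 0) (+ 0)) ℕ.+ hits ∞ (pt (+ 0) ℓ) y (pt (+ 0) (+ 1))) ≡ 0
      miss ℓ = cong₂ ℕ._+_ (miss₀ ∞) (cong₂ ℕ._+_ (miss₀ (pt (+ 0) (+ 0))) (miss₀ (pt (+ 0) (+ 1))))
        where
        miss₀ : ∀ q → hits ∞ (pt (+ 0) ℓ) y q ≡ 0
        miss₀ q = hits-zeroˡ ∞ (pt (+ 0) ℓ) y q λ _ _ → refl

  ∑-zero-external : ∀ {f} → (∀ i → f i ≡ 0) → ∑ (allFin (length external)) f ≡ 0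
  ∑-zero-external = ∑-zero (allFin (length external))

  -- Both finite points of the cone differ from the nesting point by 3t in the first coordinate,
  -- while the level differences 2 and 1 are opposite modulo 3. In a fixed level direction the cone
  -- therefore uses 3t and -3t.
  added-cone : ∀ a k b l → added (orbit cone) (pt a k) (pt b l)
             ≡ D n (b - a - T * + 3) ℕ.* (D 3 (l - k - + 1) ℕ.+ D 3 (l - k + + 1))
  added-cone a k b l = begin
    added (orbit cone) x y
      ≡⟨ added-orbit cone x y ⟩
    ∑ (block cone) (λ p → hits x p y z)
      ≡⟨ ∑-3 ∞ (pt (+ 0) (+ 0)) (pt (+ 0) (+ 1)) (λ p → hits x p y z) ⟩
    hits x ∞ y z ℕ.+ (hits x (pt (+ 0) (+ 0)) y z ℕ.+ hits x (pt (+ 0) (+ 1)) y z)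
      ≡⟨ cong₂ ℕ._+_ (hits-zeroˡ x ∞ y z λ _ _ → refl)
           (cong₂ ℕ._+_ (hits-pt a k (+ 0) (+ 0) b l (T * + 3) (+ 2) (drop₀ (b - a) (T * + 3)) refl)
                        (hits-pt a k (+ 0) (+ 1) b l (T * + 3) (+ 2) (drop₀ (b - a) (T * + 3)) refl)) ⟩
    δ ℕ.* D 3 (l - k - + 2) ℕ.+ δ ℕ.* D 3 (l - k - + 1)
      ≡⟨ cong (λ u → δ ℕ.* u ℕ.+ δ ℕ.* D 3 (l - k - + 1)) (D-shift (l - k - + 2) (l - k + + 1) (- + 1) (wrap (l - k))) ⟩
    δ ℕ.* D 3 (l - k + + 1) ℕ.+ δ ℕ.* D 3 (l - k - + 1)
      ≡⟨ factor δ (D 3 (l - k + + 1)) (D 3 (l - k - + 1)) ⟩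
    δ ℕ.* (D 3 (l - k - + 1) ℕ.+ D 3 (l - k + + 1)) ∎
    where
    open ≡-Reasoning
    x y z : Pt
    x = pt a k
    y = pt b l
    z = pt (T * + 3) (+ 2)
    δ : ℕ
    δ = D n (b - a - T * + 3)
    drop₀ : ∀ c u → c - (u - + 0) ≡ c - u
    drop₀ c u = cong (λ w → c - w) (ℤ.+-identityʳ u)
    wrap : ∀ κ → κ - + 2 - (κ + + 1) ≡ - + 1 * + 3
    wrap = solve-∀
    factor : ∀ δ q p → δ ℕ.* q ℕ.+ δ ℕ.* p ≡ δ ℕ.* (p ℕ.+ q)
    factor = ℕ-Solver.solve-∀

  added-internal : ∀ β a k b l → let c = b - a ; κ = l - k in
    added (orbit (internalBlock β)) (pt a k) (pt b l)
    ≡ D 3 (κ - + 1) ℕ.* (D n (c + (centre β + radius β)) ℕ.+ D n (c + (centre β - radius β)))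
      ℕ.+ D 3 κ ℕ.* D n (c + centre β)
  added-internal β a k b l = begin
    added (orbit (internalBlock β)) x y
      ≡⟨ added-orbit (internalBlock β) x y ⟩
    ∑ (block (internalBlock β)) (λ p → hits x p y z)
      ≡⟨ ∑-3 (pt (S + d) (+ 0)) (pt (S - d) (+ 0)) (pt S (+ 1)) (λ p → hits x p y z) ⟩
    hits x (pt (S + d) (+ 0)) y z ℕ.+ (hits x (pt (S - d) (+ 0)) y z ℕ.+ hits x (pt S (+ 1)) y z)
      ≡⟨ cong₂ ℕ._+_ (hits-pt a k (S + d) (+ 0) b l (+ 0) (+ 1) (flip (b - a) (S + d)) refl)
           (cong₂ ℕ._+_ (hits-pt a k (S - d) (+ 0) b l (+ 0) (+ 1) (flip (b - a) (S - d)) refl)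
                        (hits-pt a k S (+ 1) b l (+ 0) (+ 1) (flip (b - a) S) (ℤ.+-identityʳ (l - k)))) ⟩
    D n (b - a + (S + d)) ℕ.* D 3 (l - k - + 1) ℕ.+ (D n (b - a + (S - d)) ℕ.* D 3 (l - k - + 1) ℕ.+ D n (b - a + S) ℕ.* D 3 (l - k))
      ≡⟨ collect (D n (b - a + (S + d))) (D n (b - a + (S - d))) (D n (b - a + S)) (D 3 (l - k - + 1)) (D 3 (l - k)) ⟩
    D 3 (l - k - + 1) ℕ.* (D n (b - a + (S + d)) ℕ.+ D n (b - a + (S - d))) ℕ.+ D 3 (l - k) ℕ.* D n (b - a + S) ∎
    where
    open ≡-Reasoning
    x y z : Pt
    x = pt a k
    y = pt b l
    z = pt (+ 0) (+ 1)
    S d : ℤ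
    S = centre β
    d = radius β
    flip : ∀ c u → c - (+ 0 - u) ≡ c + u
    flip = solve-∀
    collect : ∀ u v w p e → u ℕ.* p ℕ.+ (v ℕ.* p ℕ.+ w ℕ.* e) ≡ p ℕ.* (u ℕ.+ v) ℕ.+ e ℕ.* w
    collect = ℕ-Solver.solve-∀

  mixedCount pureCount : ℤ → ℕ
  mixedCount c = ∑ internal (λ β → D n (c + (centre β + radius β)) ℕ.+ D n (c + (centre β - radius β)))
  pureCount c = ∑ internal (λ β → D n (c + centre β))

  added-pt-pt : ∀ a k b l → let c = b - a ; κ = l - k in
    added L (pt a k) (pt b l)
    ≡ D n (c - T * + 3) ℕ.* (D 3 (κ - + 1) ℕ.+ D 3 (κ + + 1)) ℕ.+ (D 3 (κ - + 1) ℕ.* mixedCount c ℕ.+ D 3 κ ℕ.* pureCount c)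
  added-pt-pt a k b l = trans (∑-L _) (cong₂ ℕ._+_
    (∑-zero (downFrom n) λ g → ℕ.*-zeroʳ (mem (pt a k) (fibre g)))
    (cong₂ ℕ._+_ (added-cone a k b l) (trans (cong₂ ℕ._+_
      (trans (∑-cong internal λ β → added-internal β a k b l)
        (trans (∑-+ internal _ _) (cong₂ ℕ._+_ (∑-*ˡ (D 3 (l - k - + 1)) internal _) (∑-*ˡ (D 3 (l - k)) internal _))))
      (∑-zero-external λ i → added-missed-nest (externalBlock i) (pt a k) (pt b l) λ _ _ → refl))
      (ℕ.+-identityʳ _))))

  added-∞-pt : ∀ b l → added L ∞ (pt b l) ≡ 1
  added-∞-pt b l = trans (∑-L _) (cong₂ ℕ._+_
    (∑-zero (downFrom n) λ g → ℕ.*-zeroʳ (mem ∞ (fibre g)))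
    (cong₂ ℕ._+_ cone-1 (cong₂ ℕ._+_
      (∑-zero internal λ β → added-missed (internalBlock β) ∞ (pt b l) (missed-bose (centre β) (radius β) (pt (+ 0) (+ 1))))
      (∑-zero-external λ i → added-missed (externalBlock i) ∞ (pt b l) (missed-bose (+ 0) (lookup external i) (ν (suc i)))))))
    where
    z = pt (T * + 3) (+ 2)
    cone-1 : added (orbit cone) ∞ (pt b l) ≡ 1
    cone-1 = trans (added-orbit cone ∞ (pt b l)) (trans (∑-3 ∞ (pt (+ 0) (+ 0)) (pt (+ 0) (+ 1)) (λ p → hits ∞ p (pt b l) z))
      (cong₂ ℕ._+_ (hits-∞-pt b l (T * + 3) (+ 2))
        (cong₂ ℕ._+_ (hits-zeroˡ ∞ (pt (+ 0) (+ 0)) (pt b l) z λ _ _ → refl) (hits-zeroˡ ∞ (pt (+ 0) (+ 1)) (pt b l) z λ _ _ → refl))))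

  added-∞ : ∀ x → added L x ∞ ≡ 0
  added-∞ x = trans (∑-L _) (cong₂ ℕ._+_
    (∑-zero (downFrom n) λ g → ℕ.*-zeroʳ (mem x (fibre g)))
    (cong₂ ℕ._+_ (added-missed-nest cone x ∞ λ _ _ → refl) (cong₂ ℕ._+_
      (∑-zero internal λ β → added-missed-nest (internalBlock β) x ∞ λ _ _ → refl)
      (∑-zero-external λ i → added-missed-nest (externalBlock i) x ∞ λ _ _ → refl))))

  added-∞-ν : ∀ j → added L ∞ (ν j) ≡ 0
  added-∞-ν j = trans (∑-L _) (cong₂ ℕ._+_
    (∑-zero (downFrom n) λ g → cong (ℕ._* 𝟙 (j ≟ zero)) (mem-fibre-∞ g))
    (cong₂ ℕ._+_ (added-missed-nest cone ∞ (ν j) λ _ _ → refl) (cong₂ ℕ._+_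
      (∑-zero internal λ β → added-missed-nest (internalBlock β) ∞ (ν j) λ _ _ → refl)
      (∑-zero-external λ i → added-missed (externalBlock i) ∞ (ν j) (missed-bose (+ 0) (lookup external i) (ν (suc i)))))))

  -- A finite old point lies in one fibre and in three translates of each Bose triple, one for each
  -- base point.
  added-pt-ν : ∀ a k j → added L (pt a k) (ν j) ≡ 𝟙 (j ≟ zero) ℕ.+ 3 ℕ.* ∑ (allFin (length external)) (λ i → 𝟙 (j ≟ suc i))
  added-pt-ν a k j = trans (∑-L _) (cong₂ ℕ._+_
    (trans (∑-*ʳ (downFrom n) (λ g → mem (pt a k) (fibre g)) (𝟙 (j ≟ zero)))
      (trans (cong (ℕ._* 𝟙 (j ≟ zero)) (trans (∑-cong (downFrom n) (mem-fibre a k)) (∑-residues n a))) (ℕ.*-identityˡ (𝟙 (j ≟ zero)))))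
    (cong₂ ℕ._+_ (added-missed-nest cone (pt a k) (ν j) λ _ _ → refl) (cong₂ ℕ._+_
      (∑-zero internal λ β → added-missed-nest (internalBlock β) (pt a k) (ν j) λ _ _ → refl)
      (trans (∑-cong (allFin (length external)) external-3) (∑-*ˡ 3 (allFin (length external)) _)))))
    where
    thrice : ∀ u → u ℕ.+ (u ℕ.+ u) ≡ 3 ℕ.* u
    thrice = ℕ-Solver.solve-∀
    external-3 : ∀ i → added (orbit (externalBlock i)) (pt a k) (ν j) ≡ 3 ℕ.* 𝟙 (j ≟ suc i)
    external-3 i = trans (added-orbit (externalBlock i) (pt a k) (ν j))
      (trans (∑-3 (pt (+ 0 + d) (+ 0)) (pt (+ 0 - d) (+ 0)) (pt (+ 0) (+ 1)) (λ p → hits (pt a k) p (ν j) (ν (suc i))))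
        (trans (cong₂ ℕ._+_ (hits-pt-ν a k (+ 0 + d) (+ 0) j (suc i))
          (cong₂ ℕ._+_ (hits-pt-ν a k (+ 0 - d) (+ 0) j (suc i)) (hits-pt-ν a k (+ 0) (+ 1) j (suc i))))
          (thrice (𝟙 (j ≟ suc i)))))
      where d = lookup external i

  added-pt-ν-≤ : ∀ a k j → added L (pt a k) (ν j) ≤ 3
  added-pt-ν-≤ a k j = subst (_≤ 3) (sym (added-pt-ν a k j)) (bound j)
    where
    bound : ∀ j → 𝟙 (j ≟ zero) ℕ.+ 3 ℕ.* ∑ (allFin (length external)) (λ i → 𝟙 (j ≟ suc i)) ≤ 3
    bound zero    = subst (λ u → 1 ℕ.+ 3 ℕ.* u ≤ 3) (sym (∑-zero-external λ _ → refl)) (s≤s z≤n)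
    bound (suc j) = ℕ.≤-reflexive (cong (3 ℕ.*_) (trans
      (∑-cong (allFin (length external)) λ i → 𝟙-cong (suc j ≟ suc i) (j ≟ i) Fin.suc-injective (cong suc))
      (∑-allFin j)))

  -- The level difference selects the bound: `pure-star` when it is 0, `mixed-star` at `c` or at
  -- `c′` when it is 1 or -1. Reversing the order exchanges `p` and `q` and swaps the two cone
  -- terms.
  added-pt-pt-≤ : ∀ a k b l → added L (pt a k) (pt b l) ℕ.+ added L (pt b l) (pt a k) ≤ 1
  added-pt-pt-≤ a k b l = begin
    added L (pt a k) (pt b l) ℕ.+ added L (pt b l) (pt a k)
      ≡⟨ cong₂ ℕ._+_ (added-pt-pt a k b l) (added-pt-pt b l a k) ⟩
    (D n (c - T * + 3) ℕ.* (p ℕ.+ q) ℕ.+ (p ℕ.* mixedCount c ℕ.+ e ℕ.* pureCount c))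
      ℕ.+ (D n (c′ - T * + 3) ℕ.* (D 3 (k - l - + 1) ℕ.+ D 3 (k - l + + 1)) ℕ.+ (D 3 (k - l - + 1) ℕ.* mixedCount c′ ℕ.+ D 3 (k - l) ℕ.* pureCount c′))
      ≡⟨ cong₂ (λ u w → (D n (c - T * + 3) ℕ.* (p ℕ.+ q) ℕ.+ (p ℕ.* mixedCount c ℕ.+ e ℕ.* pureCount c)) ℕ.+ (D n (c′ - T * + 3) ℕ.* u ℕ.+ w))
           (cong₂ ℕ._+_ q≡ p≡) (cong₂ (λ u w → u ℕ.* mixedCount c′ ℕ.+ w ℕ.* pureCount c′) q≡ (D-flip k l)) ⟩
    (D n (c - T * + 3) ℕ.* (p ℕ.+ q) ℕ.+ (p ℕ.* mixedCount c ℕ.+ e ℕ.* pureCount c))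
      ℕ.+ (D n (c′ - T * + 3) ℕ.* (q ℕ.+ p) ℕ.+ (q ℕ.* mixedCount c′ ℕ.+ e ℕ.* pureCount c′))
      ≡⟨ collect (D n (c - T * + 3)) (D n (c′ - T * + 3)) p q e (mixedCount c) (mixedCount c′) (pureCount c) (pureCount c′) ⟩
    e ℕ.* (pureCount c′ ℕ.+ pureCount c) ℕ.+ (p ℕ.* (mixedCount c ℕ.+ (D n (c - T * + 3) ℕ.+ D n (c′ - T * + 3)))
                         ℕ.+ q ℕ.* (mixedCount c′ ℕ.+ (D n (c′ - T * + 3) ℕ.+ D n (c - T * + 3))))
      ≤⟨ ℕ.+-mono-≤ (ℕ.*-monoʳ-≤ e pure) (ℕ.+-mono-≤
           (ℕ.*-monoʳ-≤ p (subst (λ u → mixedCount c ℕ.+ (D n (c - T * + 3) ℕ.+ u) ≤ 1) (sym (negate a b (T * + 3))) (mixed-star c)))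
           (ℕ.*-monoʳ-≤ q (subst (λ u → mixedCount c′ ℕ.+ (D n (c′ - T * + 3) ℕ.+ u) ≤ 1) (sym (negate b a (T * + 3))) (mixed-star c′)))) ⟩
    e ℕ.* 1 ℕ.+ (p ℕ.* 1 ℕ.+ q ℕ.* 1)
      ≡⟨ cong₂ ℕ._+_ (ℕ.*-identityʳ e) (cong₂ ℕ._+_ (ℕ.*-identityʳ p) (ℕ.*-identityʳ q)) ⟩
    e ℕ.+ (p ℕ.+ q)
      ≡⟨ ∑-D3 κ ⟩
    1 ∎
    where
    open ℕ.≤-Reasoning
    c c′ κ : ℤ
    c = b - a
    c′ = a - b
    κ = l - k
    e p q : ℕ
    e = D 3 κ
    p = D 3 (κ - + 1)
    q = D 3 (κ + + 1)
    neg⁻ : ∀ k l → - (k - l - + 1) ≡ l - k + + 1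
    neg⁻ = solve-∀
    neg⁺ : ∀ k l → - (k - l + + 1) ≡ l - k - + 1
    neg⁺ = solve-∀
    q≡ : D 3 (k - l - + 1) ≡ q
    q≡ = trans (sym (D-neg (k - l - + 1))) (cong (D 3) (neg⁻ k l))
    p≡ : D 3 (k - l + + 1) ≡ p
    p≡ = trans (sym (D-neg (k - l + + 1))) (cong (D 3) (neg⁺ k l))
    negate : ∀ a b u → D n (a - b - u) ≡ D n (b - a + u)
    negate a b u = trans (sym (D-neg (a - b - u))) (cong (D n) (lemma a b u))
      where
      lemma : ∀ a b u → - (a - b - u) ≡ b - a + u
      lemma = solve-∀
    pure : pureCount c′ ℕ.+ pureCount c ≤ 1
    pure = subst (_≤ 1) (trans (∑-+ internal _ _) (cong (ℕ._+ pureCount c)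
             (∑-cong internal λ β → trans (sym (D-neg (c - centre β))) (cong (D n) (lemma a b (centre β)))))) (pure-star c)
      where
      lemma : ∀ a b S → - (b - a - S) ≡ a - b + S
      lemma = solve-∀
    collect : ∀ x y p q e m m′ v v′ →
      (x ℕ.* (p ℕ.+ q) ℕ.+ (p ℕ.* m ℕ.+ e ℕ.* v)) ℕ.+ (y ℕ.* (q ℕ.+ p) ℕ.+ (q ℕ.* m′ ℕ.+ e ℕ.* v′))
      ≡ e ℕ.* (v′ ℕ.+ v) ℕ.+ (p ℕ.* (m ℕ.+ (x ℕ.+ y)) ℕ.+ q ℕ.* (m′ ℕ.+ (y ℕ.+ x)))
    collect = ℕ-Solver.solve-∀

  covered-2 : ∀ {x y} → Old x → Old y → Δ x y ≡ 0 → covered L x y ≡ 2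
  covered-2 (pt a k) (pt b l) apart = covered-pt-pt a k b l apart
  covered-2 (pt a k) ∞        _     = trans (covered-sym L (pt a k) ∞) (covered-∞-pt a k)
  covered-2 ∞        (pt b l) _     = covered-∞-pt b l

  total : Pt → Pt → ℕ
  total x y = covered L x y ℕ.+ (added L x y ℕ.+ added L y x)

  total-sym : ∀ x y → total x y ≡ total y x
  total-sym x y = cong₂ ℕ._+_ (covered-sym L x y) (ℕ.+-comm (added L x y) (added L y x))

  total-∞-pt : ∀ b l → total ∞ (pt b l) ≡ 3
  total-∞-pt b l = cong₂ ℕ._+_ (covered-∞-pt b l) (cong₂ ℕ._+_ (added-∞-pt b l) (added-∞ (pt b l)))

  total-ν : ∀ j y → added L y (ν j) ≤ 3 → total (ν j) y ≤ 3
  total-ν j y = subst (_≤ 3) (sym (cong₂ ℕ._+_ (covered-ν proper j y) (cong (ℕ._+ added L y (ν j)) (added-ν proper j y))))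

  added-ν-≤ : ∀ y j → added L y (ν j) ≤ 3
  added-ν-≤ (pt a k) j = added-pt-ν-≤ a k j
  added-ν-≤ ∞        j = subst (_≤ 3) (sym (added-∞-ν j)) z≤n
  added-ν-≤ (ν i)    j = subst (_≤ 3) (sym (added-ν proper i (ν j))) z≤n

  total-≤3 : ∀ x y → Δ x y ≡ 0 → total x y ≤ 3
  total-≤3 (ν i)      y          _     = total-ν i y (added-ν-≤ y i)
  total-≤3 x          (ν j)      _     = subst (_≤ 3) (total-sym (ν j) x) (total-ν j x (added-ν-≤ x j))
  -- The bound is 2 + 1: the original blocks use two, and the nestings in both directions leave at
  -- most one.
  total-≤3 (pt a k)   (pt b l)   apart = ℕ.+-mono-≤ (ℕ.≤-reflexive (covered-pt-pt a k b l apart)) (added-pt-pt-≤ a k b l)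
  total-≤3 (pt a k)   ∞          _     = ℕ.≤-reflexive (trans (total-sym (pt a k) ∞) (total-∞-pt a k))
  total-≤3 ∞          (pt b l)   _     = ℕ.≤-reflexive (total-∞-pt b l)

  open Realise L proper covered-2 total-≤3 public using (𝒜; φ; isWeakNesting)

  v≡ : v ≡ 12 ℕ.* t ℕ.+ 4
  v≡ = lemma t
    where
    lemma : ∀ t → suc (t ℕ.* 4) ℕ.* 3 ℕ.+ 1 ≡ 12 ℕ.* t ℕ.+ 4
    lemma = ℕ-Solver.solve-∀

  w≡ : N ≡ 14 ℕ.* t ℕ.+ 6
  w≡ = trans (cong (λ m → v ℕ.+ suc m) length-external) (lemma t)
    where
    lemma : ∀ t → suc (t ℕ.* 4) ℕ.* 3 ℕ.+ 1 ℕ.+ suc (suc (t ℕ.* 2)) ≡ 14 ℕ.* t ℕ.+ 6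
    lemma = ℕ-Solver.solve-∀

open import Data.Nat using (_+_; _*_)

theorem3p5 : ∀ (t : ℕ) → 2 ≤ t →
    Σ[ n ∈ ℕ ] Σ[ X ∈ Subset n ] Σ[ Y ∈ Subset n ] Σ[ 𝒜 ∈ List (Subset n) ]
    Σ[ φ ∈ (Fin (length 𝒜) → Fin n) ]
    IsWeakNesting (12 * t + 4) (14 * t + 6) 3 2 X Y 𝒜 φ
theorem3p5 (suc s) _ = N , X , ⊤ , 𝒜 , φ ,
  subst₂ (λ v w → IsWeakNesting v w 3 2 X ⊤ 𝒜 φ) v≡ w≡ isWeakNesting
  where
  open Design s
  open Points (Family.n s) (suc (length (Family.external s))) using (N; X)
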